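{- Let $A$ be a general event structure. For every event structure with equivalence $Q$ and every map $f:\mathit{ges}(Q)\to A$ of general event structures, there is a map $h:Q\to\mathit{er}(A)$ of event structures with equivalence such that $f=\max_A\circ\mathit{ges}(h)$. Moreover, if $h':Q\to\mathit{er}(A)$ is any map of event structures with equivalence with $f=\max_A\circ\mathit{ges}(h')$, then $h'\equiv h$.
   Context: A (prime) event structure $(E,\le,\mathrm{Con})$: a set $E$, a partial order $\le$, and a nonempty family $\mathrm{Con}$ of finite subsets of $E$ such that $[e]=\{e'\mid e'\le e\}$ is finite for each $e$, $\{e\}\in\mathrm{Con}$, $\mathrm{Con}$ is closed under subsets, and $X\in\mathrm{Con}$, $e\le e'\in X$ imply $X\cup\{e\}\in\mathrm{Con}$. A configuration is a down-closed subset all of whose finite subsets lie in $\mathrm{Con}$. An event structure with equivalence (ese) $(P,\le,\mathrm{Con},\equiv)$ is an event structure with an equivalence relation $\equiv$ on $P$. A map of ese's $f:P\to Q$ is a partial function preserving $\equiv$ (if $p_1\equiv p_2$ then $f(p_1),f(p_2)$ are both undefined or both defined and $f(p_1)\equiv_Q f(p_2)$) such that for every finite configuration $x$ of $P$, the image $fx$ is a finite configuration of $Q$ and for $p_1,p_2\in x$, $f(p_1)\equiv_Q f(p_2)$ implies $p_1\equiv_P p_2$. Two maps $f_1,f_2:P\to Q$ are equivalent, $f_1\equiv f_2$, iff they are defined on the same elements and $f_1(p)\equiv_Q f_2(p)$ wherever defined. A general event structure is $(E,\mathrm{Con},\vdash)$ with $\mathrm{Con}$ a nonempty subset-closed family of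 finite subsets of $E$ and $\vdash\subseteq\mathrm{Con}\times E$ such that $Y\in\mathrm{Con}$, $X\subseteq Y$, $X\vdash e$ imply $Y\vdash e$. Its configurations are the consistent (all finite subsets in $\mathrm{Con}$) and secured (each $e\in x$ has $e_1,\dots,e_n=e$ in $x$ with $\{e_1,\dots,e_{i-1}\}\vdash e_i$) subsets; $\mathcal C^\infty(A)$ denotes them. A map of general event structures $f:(E,\mathrm{Con},\vdash)\to(E',\mathrm{Con}',\vdash')$ is a partial function such that $X\in\mathrm{Con}$ implies $fX\in\mathrm{Con}'$ and $f$ is injective on $X$ where defined, and $X\vdash e$ with $f(e)$ defined implies $fX\vdash' f(e)$. $\mathit{ges}(P)$ for an ese $P$: events are the $\equiv$-classes $P/{\equiv}$; a set $X$ of classes is consistent iff $X=\{\{p\}_\equiv\mid p\in Y\}$ for some $Y\in\mathrm{Con}$; $X\vdash e$ iff $X$ is consistent and there is $p\in P$ with $e=\{p\}_\equiv$ and $\{\{p'\}_\equiv\mid p'\le p\}\subseteq X\cup\{e\}$. For a map $f$ of ese's, $\mathit{ges}(f)$ is the partial function induced on equivalence classes. Causal realisations of a family $\mathcal A$ of sets with $A=\bigcup\mathcal A$: a partial order $(E,\le)$ with finite down-sets and $\rho:E\to A$ with $\rho x\in\mathcal A$ for all down-closed $x\subseteq E$; a map of realisations is a partial surjection preserving down-closed subsets and commuting with the $\rho$'s where defined; write $\rho'\preceq\rho$ if there is a map from $\rho$ to $\rho'$; $\rho$ is extremal if every total map out of $\rho$ is an isomorphism. $\mathit{er}(A)=(P,\le_P,\mathrm{Con}_P,\equiv_P)$: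 $P$ is a choice of one representative per isomorphism class of extremal realisations of $\mathcal C^\infty(A)$ with a top element; $\max_A(p)$ is the image of the top element; $\le_P$ is $\preceq$; finite $X$ is consistent iff $\max_A[X]\in\mathcal C^\infty(A)$ ($[X]$ the down-closure); $p_1\equiv_P p_2$ iff $\max_A(p_1)=\max_A(p_2)$. The map $\max_A:\mathit{ges}(\mathit{er}(A))\to A$ sends the class of $p$ to $\max_A(p)$. -}

module Defs where

open import Level using (Level; Setω; _⊔_; Lift) renaming (suc to lsuc)
open import Axiom.ExcludedMiddle using (ExcludedMiddle)
open import Data.Bool.Properties using (T-irrelevant)
open import Data.Empty using (⊥-elim)
open import Data.Empty.Polymorphic using (⊥)
open import Data.List.Base
  using (List; []; _∷_; [_]; _++_; length; map; mapMaybe; concatMap; filter; deduplicate)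
open import Data.List.Membership.Propositional using (_∈_)
open import Data.List.Membership.Propositional.Properties
  using (∈-map⁺; ∈-map⁻; ∈-∃++; ∈-filter⁺; ∈-filter⁻; ∈-++⁺ˡ; ∈-++⁺ʳ; ∈-++⁻;
         ∈-concatMap⁺; ∈-concatMap⁻; ∈-deduplicate⁺)
open import Data.List.Properties using (length-++; length-mapMaybe)
open import Data.List.Relation.Binary.Subset.Propositional using (_⊆_)
open import Data.List.Relation.Unary.All as All using (All; []; _∷_)
open import Data.List.Relation.Unary.Any as Any using (here; there)
open import Data.List.Relation.Unary.Unique.Propositional using (Unique)
open import Data.List.Relation.Unary.Unique.DecPropositional.Properties
  using (deduplicate-!)
open import Data.List.Relation.Unary.AllPairs using ([]; _∷_)
import Data.List.Membership.Propositional as Membership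
import Data.List.Membership.Setoid as SetoidMembership
import Data.List.Membership.Setoid.Properties as SetoidMembershipₚ
import Data.List.Relation.Binary.Subset.Setoid as SetoidSubset
open import Data.Maybe.Base as Maybe using (Maybe; just; nothing; _>>=_)
open import Data.Maybe.Properties using (just-injective)
open import Data.Maybe.Relation.Binary.Pointwise as Pointwise
  using (Pointwise)
open import Data.Nat.Base as ℕ using (suc; z≤n; s≤s)
import Data.Nat.Properties as ℕₚ
open import Data.Product.Base using (Σ; ∃; ∃₂; _×_; _,_; proj₁; proj₂)
open import Data.Unit.Base using (⊤)
open import Data.Sum.Base using (_⊎_; inj₁; inj₂)
open import Function.Base using (_∘_; id; case_of_)
open import Relation.Binary.Bundles using (Setoid)
open import Relation.Binary.Core using (Rel; REL)
open import Relation.Binary.Definitions using (_Respects_)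
open import Relation.Binary.Structures using (IsEquivalence; IsPartialOrder)
open import Relation.Binary.PropositionalEquality as ≡ using (_≡_; _≢_; refl)
open import Relation.Nullary.Decidable using (Dec; yes; no; True; toWitness; fromWitness)
open import Relation.Nullary.Negation using (¬_; contradiction)
open import Relation.Unary using (Pred; U; _≐_) renaming (_⊆_ to _⊑_)

private
  variable
    a b c d ℓ ℓ′ ℓ₁ ℓ₂ ℓ₃ ℓ₄ p u : Level

-- Existence of extremal realisations, and hence the results on er, need
-- classical logic.  For all types, not only propositions, so choice is included.

Classical : Setω
Classical = ∀ {ℓ} → ExcludedMiddle ℓ

-- Finite subsets are given by lists, considered up to having the same members.

Finite : {A : Set a} → Pred A ℓ → Set (a ⊔ ℓ)
Finite x = ∃ λ xs → x ≐ (_∈ xs)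

DownClosed : {A : Set a} → Rel A ℓ₁ → Pred A ℓ₂ → Set (a ⊔ ℓ₁ ⊔ ℓ₂)
DownClosed _≤_ x = ∀ {d e} → d ≤ e → x e → x d

image : {A : Set a} {B : Set b} → (A → Maybe B) → Pred A ℓ → Pred B (a ⊔ b ⊔ ℓ)
image f x b = ∃ λ a → x a × f a ≡ just b

Congruent : (S : Setoid a ℓ₁) (T : Setoid b ℓ₂) →
            (Setoid.Carrier S → Maybe (Setoid.Carrier T)) → Set (a ⊔ b ⊔ ℓ₁ ⊔ ℓ₂)
Congruent S T f = ∀ {x y} → x S.≈ y → Pointwise T._≈_ (f x) (f y)
  where
    module S = Setoid S
    module T = Setoid T

module PartialFunctions where

  module _ (S : Setoid a ℓ₁) where
    private
      module S = Setoid S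
      module SM = SetoidMembership S

    find : ∀ {x X} → x SM.∈ X → ∃ λ y → y ∈ X × x S.≈ y
    find (here x≈y) = _ , here refl , x≈y
    find (there x∈) = let y , y∈ , x≈y = find x∈ in y , there y∈ , x≈y

  module _ (S : Setoid a ℓ₁) (T : Setoid b ℓ₂) where
    private
      module S = Setoid S
      module T = Setoid T
      module SM = SetoidMembership S
      module TM = SetoidMembership T
      module SS = SetoidSubset S
      module TS = SetoidSubset T

    ∈-mapMaybe⁻ₛ : ∀ (f : S.Carrier → Maybe T.Carrier) X {y} → y TM.∈ mapMaybe f X →
                   ∃₂ λ x y′ → x ∈ X × f x ≡ just y′ × y T.≈ y′
    ∈-mapMaybe⁻ₛ f (x ∷ X) y∈ with f x in eq
    ... | nothing = let x′ , y′ , q , r = ∈-mapMaybe⁻ₛ f X y∈ in x′ , y′ , there q , r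
    ∈-mapMaybe⁻ₛ f (x ∷ X) (here y≈) | just z = x , z , here refl , eq , y≈
    ∈-mapMaybe⁻ₛ f (x ∷ X) (there y∈) | just z =
      let x′ , y′ , q , r = ∈-mapMaybe⁻ₛ f X y∈ in x′ , y′ , there q , r

    ∈-mapMaybe⁺ₛ : ∀ {f} → Congruent S T f → ∀ X {x y} → x SM.∈ X → f x ≡ just y →
                   y TM.∈ mapMaybe f X
    ∈-mapMaybe⁺ₛ {f} cong (z ∷ X) (here x≈z) eq with f z | ≡.subst (λ m → Pointwise T._≈_ m (f z)) eq (cong x≈z)
    ... | just _ | Pointwise.just y≈ = here y≈
    ∈-mapMaybe⁺ₛ {f} cong (z ∷ X) (there x∈) eq with f z
    ... | nothing = ∈-mapMaybe⁺ₛ cong X x∈ eq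
    ... | just _  = there (∈-mapMaybe⁺ₛ cong X x∈ eq)

    defined : ∀ {f} → Congruent S T f → ∀ {x x′ y} → x S.≈ x′ → f x ≡ just y →
              ∃ λ y′ → f x′ ≡ just y′ × y T.≈ y′
    defined {f} cong {x′ = x′} x≈ eq =
      Pointwise.just-inv (≡.subst (λ m → Pointwise T._≈_ m (f x′)) eq (cong x≈))

    mapMaybe-⊆ₛ : ∀ {f} → Congruent S T f → ∀ {X Y} → X SS.⊆ Y → mapMaybe f X TS.⊆ mapMaybe f Y
    mapMaybe-⊆ₛ {f} cong {X} {Y} X⊆Y y∈ =
      let x , y′ , x∈ , eq , y≈ = ∈-mapMaybe⁻ₛ f X y∈
      in SetoidMembershipₚ.∈-resp-≈ T (T.sym y≈)
           (∈-mapMaybe⁺ₛ cong Y (X⊆Y (Any.map S.reflexive x∈)) eq)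

  ∈-mapMaybe⁻ : {A : Set a} {B : Set b} (f : A → Maybe B) (X : List A) {y : B} →
                y ∈ mapMaybe f X → ∃ λ x → x ∈ X × f x ≡ just y
  ∈-mapMaybe⁻ f X y∈ with ∈-mapMaybe⁻ₛ (≡.setoid _) (≡.setoid _) f X y∈
  ... | x , _ , x∈ , eq , refl = x , x∈ , eq

  ∈-mapMaybe⁺ : {A : Set a} {B : Set b} (f : A → Maybe B) (X : List A) {x : A} {y : B} →
                x ∈ X → f x ≡ just y → y ∈ mapMaybe f X
  ∈-mapMaybe⁺ f = ∈-mapMaybe⁺ₛ (≡.setoid _) (≡.setoid _) (λ { refl → Pointwise.refl refl })

  Finite-resp-≐ : {A : Set a} {x : Pred A ℓ₁} {y : Pred A ℓ₂} → x ≐ y → Finite x → Finite y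
  Finite-resp-≐ (f , g) (xs , h , k) = xs , h ∘ g , f ∘ k

  Finite-image : {A : Set a} {B : Set b} (f : A → Maybe B) {x : Pred A ℓ} →
                 Finite x → Finite (image f x)
  Finite-image f (xs , h , k) =
    mapMaybe f xs ,
    (λ (a , xa , eq) → ∈-mapMaybe⁺ f xs (h xa) eq) ,
    (λ b∈ → let a , a∈ , eq = ∈-mapMaybe⁻ f xs b∈ in a , k a∈ , eq)

  Finite-⊆ : Classical → {A : Set a} {x : Pred A ℓ₁} {y : Pred A ℓ₂} → y ⊑ x → Finite x → Finite y
  Finite-⊆ em {y = y} y⊑x (xs , h , k) =
    filter (λ a → em {P = y a}) xs ,
    (λ ya → ∈-filter⁺ (λ a → em {P = y a}) (h (y⊑x ya)) ya) ,
    (λ a∈ → proj₂ (∈-filter⁻ (λ a → em {P = y a}) {xs = xs} a∈))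

  Unique-length : {A : Set a} {xs ys : List A} → Unique xs → xs ⊆ ys → length xs ℕ.≤ length ys
  Unique-length [] _ = z≤n
  Unique-length {xs = x ∷ xs} (x≢ ∷ uq) xs⊆ys with ∈-∃++ (xs⊆ys (here refl))
  ... | ys , zs , refl = ℕₚ.≤-trans (s≤s (Unique-length uq xs⊆))
                           (ℕₚ.≤-reflexive (≡.trans (≡.cong suc (length-++ ys))
                             (≡.trans (≡.sym (ℕₚ.+-suc _ _)) (≡.sym (length-++ ys)))))
    where
      xs⊆ : xs ⊆ ys ++ zs
      xs⊆ {y} y∈ with ∈-++⁻ ys (xs⊆ys (there y∈))
      ... | inj₁ q = ∈-++⁺ˡ q
      ... | inj₂ (here refl) = ⊥-elim (All.lookup x≢ y∈ refl)
      ... | inj₂ (there q) = ∈-++⁺ʳ ys q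

  length-mapMaybe-< : {A : Set a} {B : Set b} (f : A → Maybe B) {x : A} (xs : List A) →
                      x ∈ xs → f x ≡ nothing → length (mapMaybe f xs) ℕ.< length xs
  length-mapMaybe-< f (x ∷ xs) (here refl) eq with f x
  ... | nothing = s≤s (length-mapMaybe f xs)
  length-mapMaybe-< f (x ∷ xs) (there x∈) eq with f x
  ... | nothing = ℕₚ.m≤n⇒m≤1+n (length-mapMaybe-< f xs x∈ eq)
  ... | just _  = s≤s (length-mapMaybe-< f xs x∈ eq)

  surjection-total : Classical → {A : Set a} → Finite (U {A = A}) → (f : A → Maybe A) →
                     (∀ y → ∃ λ x → f x ≡ just y) → ∀ x → f x ≢ nothing
  surjection-total em {A = A} (xs , h , _) f surj x eq =
    ℕₚ.<-irrefl refl (ℕₚ.<-≤-trans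
      (length-mapMaybe-< f zs (∈zs x) eq)
      (Unique-length (deduplicate-! _≟_ xs)
        (λ {y} _ → let z , fz = surj y in ∈-mapMaybe⁺ f zs (∈zs z) fz)))
    where
      _≟_ : (x y : A) → Dec (x ≡ y)
      _ ≟ _ = em
      zs = deduplicate _≟_ xs
      ∈zs : ∀ z → z ∈ zs
      ∈zs z = ∈-deduplicate⁺ _≟_ {xs = xs} (h _)

  >>=-just : {A : Set a} {B : Set b} (m : Maybe A) {f : A → Maybe B} {y : B} → (m >>= f) ≡ just y →
             ∃ λ x → m ≡ just x × f x ≡ just y
  >>=-just (just x) eq = x , refl , eq

  mapMaybe-mapMaybe : {A : Set a} {B : Set b} {C : Set c} (f : A → Maybe B) (g : B → Maybe C) (X : List A) →
                      mapMaybe g (mapMaybe f X) ≡ mapMaybe (λ x → f x >>= g) X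
  mapMaybe-mapMaybe f g [] = refl
  mapMaybe-mapMaybe f g (x ∷ X) with f x
  ... | nothing = mapMaybe-mapMaybe f g X
  ... | just y with g y
  ...   | nothing = mapMaybe-mapMaybe f g X
  ...   | just z  = ≡.cong (z ∷_) (mapMaybe-mapMaybe f g X)

open PartialFunctions

record EventStructure c ℓ₁ ℓ₂ : Set (lsuc (c ⊔ ℓ₁ ⊔ ℓ₂)) where
  infix 4 _≤_
  field
    Carrier        : Set c
    _≤_            : Rel Carrier ℓ₁
    Con            : Pred (List Carrier) ℓ₂
    isPartialOrder : IsPartialOrder _≡_ _≤_
    ↓-finite       : ∀ e → Finite (_≤ e)
    Con-nonempty   : ∃ Con
    Con-singleton  : ∀ e → Con [ e ]
    Con-⊆          : ∀ {X Y} → X ⊆ Y → Con Y → Con X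
    Con-↓          : ∀ {X d e} → Con X → d ≤ e → e ∈ X → Con (d ∷ X)

  open IsPartialOrder isPartialOrder public
    using (antisym) renaming (refl to ≤-refl; trans to ≤-trans)

  record IsConfiguration (x : Pred Carrier ℓ) : Set (c ⊔ ℓ₁ ⊔ ℓ₂ ⊔ ℓ) where
    field
      down-closed : DownClosed _≤_ x
      consistent  : ∀ {X} → All x X → Con X

record ESE c ℓ₁ ℓ₂ ℓ₃ : Set (lsuc (c ⊔ ℓ₁ ⊔ ℓ₂ ⊔ ℓ₃)) where
  infix 4 _~_
  field
    eventStructure : EventStructure c ℓ₁ ℓ₂
  open EventStructure eventStructure public
  field
    _~_           : Rel Carrier ℓ₃
    isEquivalence : IsEquivalence _~_

  ~-setoid : Setoid c ℓ₃
  ~-setoid = record { isEquivalence = isEquivalence }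

  open IsEquivalence isEquivalence public
    renaming (refl to ~-refl; sym to ~-sym; trans to ~-trans; reflexive to ~-reflexive)

record ESEMap (P : ESE a ℓ₁ ℓ₂ ℓ₃) (Q : ESE b ℓ ℓ′ ℓ₄)
       : Set (a ⊔ b ⊔ ℓ₁ ⊔ ℓ₂ ⊔ ℓ₃ ⊔ ℓ ⊔ ℓ′ ⊔ ℓ₄) where
  private
    module P = ESE P
    module Q = ESE Q
  field
    fn          : P.Carrier → Maybe Q.Carrier
    preserves-~ : Congruent P.~-setoid Q.~-setoid fn
    preserves-configuration :
      ∀ X → P.IsConfiguration (_∈ X) → Q.IsConfiguration (_∈ mapMaybe fn X)
    reflects-~  :
      ∀ X → P.IsConfiguration (_∈ X) →
      ∀ {p₁ p₂ q₁ q₂} → p₁ ∈ X → p₂ ∈ X → fn p₁ ≡ just q₁ → fn p₂ ≡ just q₂ →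
      q₁ Q.~ q₂ → p₁ P.~ p₂

infix 4 _≋_

_≋_ : {P : ESE a ℓ₁ ℓ₂ ℓ₃} {Q : ESE b ℓ ℓ′ ℓ₄} → Rel (ESEMap P Q) (a ⊔ b ⊔ ℓ₄)
_≋_ {Q = Q} f g = ∀ e → Pointwise (ESE._~_ Q) (ESEMap.fn f e) (ESEMap.fn g e)

-- The set of events is a setoid, so that in ges it can be the quotient by ~.

record GES c ℓ ℓ₁ ℓ₂ : Set (lsuc (c ⊔ ℓ ⊔ ℓ₁ ⊔ ℓ₂)) where
  field
    events : Setoid c ℓ
  open Setoid events public
  open SetoidMembership events public using () renaming (_∈_ to _∈ₛ_)
  open SetoidSubset events public using () renaming (_⊆_ to _⊆ₛ_)
  infix 4 _⊢_
  field
    Con          : Pred (List Carrier) ℓ₁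
    _⊢_          : REL (List Carrier) Carrier ℓ₂
    Con-nonempty : ∃ Con
    Con-⊆        : ∀ {X Y} → X ⊆ₛ Y → Con Y → Con X
    ⊢⇒Con        : ∀ {X e} → X ⊢ e → Con X
    ⊢-mono       : ∀ {X Y e} → Con Y → X ⊆ₛ Y → X ⊢ e → Y ⊢ e
    ⊢-resp       : ∀ {X d e} → d ≈ e → X ⊢ d → X ⊢ e

  -- e₁,…,eₙ in x with {e₁,…,eᵢ₋₁} ⊢ eᵢ for each i, listed as eₙ ∷ … ∷ e₁ ∷ [].

  data Chain (x : Pred Carrier ℓ′) : Pred (List Carrier) (c ⊔ ℓ₂ ⊔ ℓ′) where
    []  : Chain x []
    _▹_ : ∀ {es e} → Chain x es → x e × es ⊢ e → Chain x (e ∷ es)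

  record IsConfiguration (x : Pred Carrier ℓ′) : Set (c ⊔ ℓ ⊔ ℓ₁ ⊔ ℓ₂ ⊔ ℓ′) where
    field
      resp       : x Respects _≈_
      consistent : ∀ {X} → All x X → Con X
      secured    : ∀ {e} → x e → ∃ λ es → Chain x (e ∷ es)

  private
    Chain-⊑ : {x : Pred Carrier a} {y : Pred Carrier b} → x ⊑ y → Chain x ⊑ Chain y
    Chain-⊑ x⊑y []               = []
    Chain-⊑ x⊑y (es ▹ (xe , ⊢e)) = Chain-⊑ x⊑y es ▹ (x⊑y xe , ⊢e)

  compatible-union :
    {x : Pred Carrier a} {z : Pred Carrier b} → x Respects _≈_ → IsConfiguration z → x ⊑ z →
    (∀ {e} → x e → Σ (Pred Carrier d) λ w → IsConfiguration w × w ⊑ x × w e) →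
    IsConfiguration x
  compatible-union x-resp z x⊑z cover = record
    { resp       = x-resp
    ; consistent = λ X → IsConfiguration.consistent z (All.map x⊑z X)
    ; secured    = λ xe → let w , cw , w⊑x , we = cover xe
                              es , ch = IsConfiguration.secured cw we
                          in es , Chain-⊑ w⊑x ch
    }

  IsConfiguration-resp-≐ : {x : Pred Carrier a} {y : Pred Carrier b} → x ≐ y →
                           IsConfiguration x → IsConfiguration y
  IsConfiguration-resp-≐ {x = x} (f , g) cx =
    compatible-union (λ eq → f ∘ IsConfiguration.resp cx eq ∘ g) cx g (λ ye → x , cx , f , g ye)

𝒞∞ : (A : GES c ℓ ℓ₁ ℓ₂) → Pred (Pred (GES.Carrier A) ℓ′) (c ⊔ ℓ ⊔ ℓ₁ ⊔ ℓ₂ ⊔ ℓ′)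
𝒞∞ A = GES.IsConfiguration A

record GESMap (A : GES a ℓ ℓ₁ ℓ₂) (B : GES b ℓ′ ℓ₃ ℓ₄)
       : Set (a ⊔ b ⊔ ℓ ⊔ ℓ₁ ⊔ ℓ₂ ⊔ ℓ′ ⊔ ℓ₃ ⊔ ℓ₄) where
  private
    module A = GES A
    module B = GES B
  field
    fn            : A.Carrier → Maybe B.Carrier
    cong          : Congruent A.events B.events fn
    preserves-Con : ∀ {X} → A.Con X → B.Con (mapMaybe fn X)
    injective     :
      ∀ {X} → A.Con X →
      ∀ {d e d′ e′} → d A.∈ₛ X → e A.∈ₛ X → fn d ≡ just d′ → fn e ≡ just e′ →
      d′ B.≈ e′ → d A.≈ e
    preserves-⊢   : ∀ {X e e′} → X A.⊢ e → fn e ≡ just e′ → mapMaybe fn X B.⊢ e′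

infix 4 _≗ᴳ_

_≗ᴳ_ : {A : GES a ℓ ℓ₁ ℓ₂} {B : GES b ℓ′ ℓ₃ ℓ₄} → Rel (GESMap A B) (a ⊔ b ⊔ ℓ′)
_≗ᴳ_ {B = B} f g = ∀ e → Pointwise (GES._≈_ B) (GESMap.fn f e) (GESMap.fn g e)

infixr 9 _∘ᴳ_

_∘ᴳ_ : {A : GES a ℓ ℓ₁ ℓ₂} {B : GES b ℓ′ ℓ₃ ℓ₄} {C : GES c u p d} →
       GESMap B C → GESMap A B → GESMap A C
_∘ᴳ_ {A = A} {B = B} {C = C} g f = record
  { fn            = λ e → f.fn e >>= g.fn
  ; cong          = λ d≈e → >>=-cong (f.cong d≈e)
  ; preserves-Con = λ {X} X∈ →
      ≡.subst C.Con (mapMaybe-mapMaybe f.fn g.fn X) (g.preserves-Con (f.preserves-Con X∈))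
  ; injective     = inj
  ; preserves-⊢   = λ {X} {e} ⊢e eq → let _ , fe , ge = >>=-just (f.fn e) eq in
      ≡.subst (C._⊢ _) (mapMaybe-mapMaybe f.fn g.fn X) (g.preserves-⊢ (f.preserves-⊢ ⊢e fe) ge)
  }
  where
    module A = GES A
    module B = GES B
    module C = GES C
    module f = GESMap f
    module g = GESMap g

    >>=-cong : ∀ {m n} → Pointwise B._≈_ m n → Pointwise C._≈_ (m >>= g.fn) (n >>= g.fn)
    >>=-cong (Pointwise.just x≈y) = g.cong x≈y
    >>=-cong Pointwise.nothing    = Pointwise.nothing

    inj : ∀ {X} → A.Con X → ∀ {d e d′ e′} → d A.∈ₛ X → e A.∈ₛ X →
          (f.fn d >>= g.fn) ≡ just d′ → (f.fn e >>= g.fn) ≡ just e′ → d′ C.≈ e′ → d A.≈ e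
    inj {X} X∈ {d} {e} d∈ e∈ eqd eqe d′≈e′ =
      let _ , fd , gd = >>=-just (f.fn d) eqd
          _ , fe , ge = >>=-just (f.fn e) eqe
      in f.injective X∈ d∈ e∈ fd fe
           (g.injective (f.preserves-Con X∈)
             (∈-mapMaybe⁺ₛ A.events B.events f.cong X d∈ fd)
             (∈-mapMaybe⁺ₛ A.events B.events f.cong X e∈ fe) gd ge d′≈e′)

ges : (P : ESE c ℓ₁ ℓ₂ ℓ₃) → GES c ℓ₃ (c ⊔ ℓ₂ ⊔ ℓ₃) (c ⊔ ℓ₁ ⊔ ℓ₂ ⊔ ℓ₃)
ges P = record
  { events       = P.~-setoid
  ; Con          = Con′
  ; _⊢_          = λ X e → Con′ X × ∃ λ p → e P.~ p × (∀ {p′} → p′ P.≤ p → p′ ∈ₛ e ∷ X)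
  ; Con-nonempty = let X , X∈ = P.Con-nonempty in X , X , X∈ , id , id
  ; Con-⊆        = Con′-⊆
  ; ⊢⇒Con        = proj₁
  ; ⊢-mono       = λ Y∈ X⊆Y (_ , p , e~p , ↓p) →
      Y∈ , p , e~p , λ p′≤p → ∷-⊆ P.~-refl X⊆Y (↓p p′≤p)
  ; ⊢-resp       = λ d~e (X∈ , p , d~p , ↓p) →
      X∈ , p , P.~-trans (P.~-sym d~e) d~p , λ p′≤p → ∷-⊆ d~e id (↓p p′≤p)
  }
  where
    module P = ESE P
    open SetoidMembership P.~-setoid using () renaming (_∈_ to _∈ₛ_)
    open SetoidSubset P.~-setoid using () renaming (_⊆_ to _⊆ₛ_)

    Con′ : Pred (List P.Carrier) _
    Con′ X = ∃ λ Y → P.Con Y × X ⊆ₛ Y × Y ⊆ₛ X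

    ∷-⊆ : ∀ {X Y d e} → d P.~ e → X ⊆ₛ Y → d ∷ X ⊆ₛ e ∷ Y
    ∷-⊆ d~e X⊆Y (here x~d)  = here (P.~-trans x~d d~e)
    ∷-⊆ d~e X⊆Y (there x∈X) = there (X⊆Y x∈X)

    select : ∀ X {Z} → X ⊆ₛ Z → ∃ λ Z′ → Z′ ⊆ Z × X ⊆ₛ Z′ × Z′ ⊆ₛ X
    select [] _ = [] , (λ ()) , id , id
    select (x ∷ X) {Z} X⊆Z =
      let z , z∈ , x~z = find P.~-setoid (X⊆Z (here P.~-refl))
          Z′ , Z′⊆Z , f , g = select X (X⊆Z ∘ there)
      in z ∷ Z′ , (λ { (here refl) → z∈ ; (there q) → Z′⊆Z q }) , ∷-⊆ x~z f , ∷-⊆ (P.~-sym x~z) g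

    Con′-⊆ : ∀ {X Y} → X ⊆ₛ Y → Con′ Y → Con′ X
    Con′-⊆ {X} X⊆Y (Z , Z∈ , Y⊆Z , _) =
      let Z′ , Z′⊆Z , X⊆Z′ , Z′⊆X = select X (Y⊆Z ∘ X⊆Y)
      in Z′ , P.Con-⊆ Z′⊆Z Z∈ , X⊆Z′ , Z′⊆X

module _ {P : ESE a ℓ₁ ℓ₂ ℓ₃} {Q : ESE b ℓ ℓ′ ℓ₄} (h : ESEMap P Q) where
  private
    module P = ESE P
    module Q = ESE Q
    module gP = GES (ges P)
    module gQ = GES (ges Q)
    module h = ESEMap h

    ↓ : List P.Carrier → List P.Carrier
    ↓ = concatMap (λ e → proj₁ (P.↓-finite e))

    ∈↓⁺ : ∀ {X d e} → e ∈ X → d P.≤ e → d ∈ ↓ X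
    ∈↓⁺ {X} e∈ d≤e = ∈-concatMap⁺ _ {xs = X} (Any.map (λ { refl → proj₁ (proj₂ (P.↓-finite _)) d≤e }) e∈)

    ∈↓⁻ : ∀ X {d} → d ∈ ↓ X → ∃ λ e → e ∈ X × d P.≤ e
    ∈↓⁻ X d∈ = let e , e∈ , q = Membership.find (∈-concatMap⁻ _ {xs = X} d∈)
               in e , e∈ , proj₂ (proj₂ (P.↓-finite e)) q

    ↓-Con : ∀ {X} → P.Con X → P.Con (↓ X)
    ↓-Con {X} X∈ = P.Con-⊆ ∈-++⁺ˡ (go (↓ X) (All.tabulate (∈↓⁻ X)))
      where
        go : ∀ Z → All (λ d → ∃ λ e → e ∈ X × d P.≤ e) Z → P.Con (Z ++ X)
        go [] [] = X∈
        go (z ∷ Z) ((e , e∈ , z≤e) ∷ qs) = P.Con-↓ (go Z qs) z≤e (∈-++⁺ʳ Z e∈)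

    ↓-configuration : ∀ {X} → P.Con X → P.IsConfiguration (_∈ ↓ X)
    ↓-configuration {X} X∈ = record
      { down-closed = λ d≤e e∈ → let e′ , e′∈ , e≤e′ = ∈↓⁻ X e∈ in ∈↓⁺ e′∈ (P.≤-trans d≤e e≤e′)
      ; consistent  = λ Y → P.Con-⊆ (All.lookup Y) (↓-Con X∈)
      }

    ⊆↓ : ∀ {X e} → e ∈ X → e ∈ ↓ X
    ⊆↓ e∈ = ∈↓⁺ e∈ P.≤-refl

    image-Con : ∀ {X} → P.Con X → Q.Con (mapMaybe h.fn X)
    image-Con {X} X∈ = Q.IsConfiguration.consistent (h.preserves-configuration _ (↓-configuration X∈))
      (All.tabulate λ q∈ → let p , p∈ , eq = ∈-mapMaybe⁻ h.fn X q∈ in ∈-mapMaybe⁺ h.fn _ (⊆↓ p∈) eq)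

    preserves-Con′ : ∀ {X} → gP.Con X → gQ.Con (mapMaybe h.fn X)
    preserves-Con′ (Y , Y∈ , X⊆Y , Y⊆X) =
      mapMaybe h.fn Y , image-Con Y∈ ,
      mapMaybe-⊆ₛ P.~-setoid Q.~-setoid h.preserves-~ X⊆Y ,
      mapMaybe-⊆ₛ P.~-setoid Q.~-setoid h.preserves-~ Y⊆X

    injective′ : ∀ {X} → gP.Con X → ∀ {d e d′ e′} → d gP.∈ₛ X → e gP.∈ₛ X →
                 h.fn d ≡ just d′ → h.fn e ≡ just e′ → d′ Q.~ e′ → d P.~ e
    injective′ (Y , Y∈ , X⊆Y , _) d∈ e∈ hd he d′~e′ =
      let y , y∈ , d~y = find P.~-setoid (X⊆Y d∈)
          z , z∈ , e~z = find P.~-setoid (X⊆Y e∈)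
          _ , hy , d′~y′ = defined P.~-setoid Q.~-setoid h.preserves-~ d~y hd
          _ , hz , e′~z′ = defined P.~-setoid Q.~-setoid h.preserves-~ e~z he
          y~z = h.reflects-~ (↓ Y) (↓-configuration Y∈) (⊆↓ y∈) (⊆↓ z∈) hy hz
                  (Q.~-trans (Q.~-sym d′~y′) (Q.~-trans d′~e′ e′~z′))
      in P.~-trans d~y (P.~-trans y~z (P.~-sym e~z))

    preserves-⊢′ : ∀ {X e e′} → X gP.⊢ e → h.fn e ≡ just e′ → mapMaybe h.fn X gQ.⊢ e′
    preserves-⊢′ {X} {e} {e′} (X∈ , p , e~p , ↓p) he =
      let p′ , hp , e′~p′ = defined P.~-setoid Q.~-setoid h.preserves-~ e~p he
      in preserves-Con′ X∈ , p′ , e′~p′ , λ r≤p′ → below hp r≤p′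
      where
        below : ∀ {p′ r} → h.fn p ≡ just p′ → r Q.≤ p′ → r gQ.∈ₛ e′ ∷ mapMaybe h.fn X
        below {p′} {r} hp r≤p′ with
          ∈-mapMaybe⁻ h.fn (↓ [ p ])
            (Q.IsConfiguration.down-closed
              (h.preserves-configuration _ (↓-configuration (P.Con-singleton p)))
              r≤p′ (∈-mapMaybe⁺ h.fn (↓ [ p ]) (⊆↓ {[ p ]} (here refl)) hp))
        ... | s , s∈ , hs with ∈↓⁻ [ p ] s∈
        ... | _ , here refl , s≤p with ↓p s≤p
        ... | there s∈X = there (∈-mapMaybe⁺ₛ P.~-setoid Q.~-setoid h.preserves-~ X s∈X hs)
        ... | here s~e with defined P.~-setoid Q.~-setoid h.preserves-~ s~e hs
        ... | _ , he′ , r~ =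
          here (Q.~-trans r~ (Q.~-reflexive (just-injective (≡.trans (≡.sym he′) he))))

  gesMap : GESMap (ges P) (ges Q)
  gesMap = record
    { fn            = h.fn
    ; cong          = h.preserves-~
    ; preserves-Con = preserves-Con′
    ; injective     = injective′
    ; preserves-⊢   = preserves-⊢′
    }

module CausalRealisation (S : Setoid u u) (𝒜 : Pred (Pred (Setoid.Carrier S) u) ℓ) where
  private
    module S = Setoid S

  labels : {E : Set u} → (E → S.Carrier) → Pred E u → Pred S.Carrier u
  labels ρ x s = ∃ λ e → x e × ρ e S.≈ s

  -- ρ has codomain S rather than ⋃ 𝒜; the case x = E of realises makes its
  -- values lie in ⋃ 𝒜.

  record Realisation : Set (lsuc u ⊔ ℓ) where
    infix 4 _≤_
    field
      Carrier        : Set u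
      _≤_            : Rel Carrier u
      isPartialOrder : IsPartialOrder _≡_ _≤_
      ↓-finite       : ∀ e → Finite (_≤ e)
      ρ              : Carrier → S.Carrier
      realises       : ∀ {x} → DownClosed _≤_ x → 𝒜 (labels ρ x)

    open IsPartialOrder isPartialOrder public
      using (antisym) renaming (refl to ≤-refl; trans to ≤-trans)

  record Map (R R′ : Realisation) : Set (lsuc u) where
    private
      module R  = Realisation R
      module R′ = Realisation R′
    field
      fn            : R.Carrier → Maybe R′.Carrier
      surjective    : ∀ e′ → ∃ λ e → fn e ≡ just e′
      preserves-↓   : ∀ {x : Pred R.Carrier u} → DownClosed R._≤_ x → DownClosed R′._≤_ (image fn x)
      commutes      : ∀ {e e′} → fn e ≡ just e′ → R.ρ e S.≈ R′.ρ e′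

    Total : Set u
    Total = ∀ e → ∃ λ e′ → fn e ≡ just e′

  -- Note the direction: a map from R to R′ makes R′ the smaller one.

  infix 4 _⪯_

  _⪯_ : Rel Realisation (lsuc u)
  R′ ⪯ R = Map R R′

  IsIso : ∀ {R R′} → Map R R′ → Set (lsuc u)
  IsIso {R} {R′} f = Σ (Map R′ R) λ g →
    (∀ e → (Map.fn f e >>= Map.fn g) ≡ just e) × (∀ e → (Map.fn g e >>= Map.fn f) ≡ just e)

  infix 4 _≅_

  _≅_ : Rel Realisation (lsuc u)
  R ≅ R′ = Σ (Map R R′) IsIso

  Extremal : Pred Realisation (lsuc u ⊔ ℓ)
  Extremal R = ∀ {R′} (f : Map R R′) → Map.Total f → IsIso f

  record TopExtremal : Set (lsuc u ⊔ ℓ) where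
    field
      realisation : Realisation
      extremal    : Extremal realisation
    open Realisation realisation public
    field
      top         : Carrier
      ≤-top       : ∀ e → e ≤ top

  record Representatives p : Set (lsuc (u ⊔ p) ⊔ ℓ) where
    field
      Index    : Set p
      rep      : Index → TopExtremal
      complete : ∀ R → ∃ λ i → TopExtremal.realisation R ≅ TopExtremal.realisation (rep i)
      unique   : ∀ {i j} → TopExtremal.realisation (rep i) ≅ TopExtremal.realisation (rep j) → i ≡ j

  module Lifting (R R′ : Realisation) (fn : Realisation.Carrier R → Maybe (Realisation.Carrier R′)) where
    private
      module R  = Realisation R
      module R′ = Realisation R′

    Lifts : Set u
    Lifts = ∀ {d′ e e′} → fn e ≡ just e′ → d′ R′.≤ e′ → ∃ λ d → d R.≤ e × fn d ≡ just d′

    lifts⇒preserves : Lifts → ∀ {x : Pred R.Carrier u} → DownClosed R._≤_ x →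
                      DownClosed R′._≤_ (image fn x)
    lifts⇒preserves lifts x↓ d′≤e′ (e , xe , fe) =
      let d , d≤e , fd = lifts fe d′≤e′ in d , x↓ d≤e xe , fd

  open Lifting using (Lifts; lifts⇒preserves)

  lifts : ∀ {R R′} (f : Map R R′) → Lifts R R′ (Map.fn f)
  lifts {R} {R′} f {e = e} fe d′≤e′ =
    Map.preserves-↓ f {_≤ e} (λ c≤d d≤e → ≤-trans c≤d d≤e) d′≤e′ (e , ≤-refl , fe)
    where open Realisation R

  ⪯-refl : ∀ {R} → R ⪯ R
  ⪯-refl {R} = record
    { fn          = just
    ; surjective  = λ e → e , refl
    ; preserves-↓ = lifts⇒preserves R R just (λ { refl d≤e → _ , d≤e , refl })
    ; commutes    = λ { refl → S.refl }
    }

  ⪯-trans : ∀ {R R′ R″} → R ⪯ R′ → R′ ⪯ R″ → R ⪯ R″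
  ⪯-trans {R} {R′} {R″} g f = record
    { fn          = gf
    ; surjective  = λ e″ → let e′ , ge = g.surjective e″
                               e , fe = f.surjective e′
                           in e , gf-just fe ge
    ; preserves-↓ = lifts⇒preserves R″ R gf λ {d″} {e} eq d″≤e″ →
        let _ , fe , ge = >>=-just (f.fn e) eq
            _ , d′≤e′ , gd = lifts g ge d″≤e″
            d , d≤e , fd = lifts f fe d′≤e′
        in d , d≤e , gf-just fd gd
    ; commutes    = λ {e} eq → let _ , fe , ge = >>=-just (f.fn e) eq
                               in S.trans (f.commutes fe) (g.commutes ge)
    }
    where
      module f = Map f
      module g = Map g
      gf = λ e → f.fn e >>= g.fn
      gf-just : ∀ {e e′ e″} → f.fn e ≡ just e′ → g.fn e′ ≡ just e″ → gf e ≡ just e″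
      gf-just {e} eq eq′ rewrite eq = eq′

  ≅-sym : ∀ {R R′} → R ≅ R′ → R′ ≅ R
  ≅-sym (f , g , gf , fg) = g , f , fg , gf

  module _ {R R′ : Realisation} (f : Map R R′) where
    private
      module R  = Realisation R
      module R′ = Realisation R′
      module f  = Map f

    Injective Monotone : Set u
    Injective = ∀ {d e e′} → f.fn d ≡ just e′ → f.fn e ≡ just e′ → d ≡ e
    Monotone  = ∀ {d e d′ e′} → f.fn d ≡ just d′ → f.fn e ≡ just e′ → d R.≤ e → d′ R′.≤ e′

    iso⇒total : IsIso f → f.Total
    iso⇒total (_ , gf , _) e = let e′ , fe , _ = >>=-just (f.fn e) (gf e) in e′ , fe

    iso⇒injective : IsIso f → Injective
    iso⇒injective (g , gf , _) {d} {e} fd fe = just-injective (≡.trans (≡.sym (gf d))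
      (≡.trans (≡.cong (_>>= Map.fn g) (≡.trans fd (≡.sym fe))) (gf e)))

    iso⇒monotone : IsIso f → Monotone
    iso⇒monotone (g , gf , fg) {d} {e} {d′} {e′} fd fe d≤e =
      let c , c≤e′ , gc = lifts g ge′ d≤e
          c≡d′ = just-injective (≡.trans (≡.sym (fg c)) (≡.trans (≡.cong (_>>= f.fn) gc) fd))
      in ≡.subst (R′._≤ e′) c≡d′ c≤e′
      where
        ge′ : Map.fn g e′ ≡ just e
        ge′ = ≡.trans (≡.cong (_>>= Map.fn g) (≡.sym fe)) (gf e)

    mk-iso : f.Total → Injective → Monotone → IsIso f
    mk-iso total inj mono = g , gf , λ e′ → proj₂ (f.surjective e′)
      where
        inv = just ∘ proj₁ ∘ f.surjective
        inv-f : ∀ {e e′} → f.fn e ≡ just e′ → inv e′ ≡ just e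
        inv-f {e′ = e′} fe = ≡.cong just (inj (proj₂ (f.surjective e′)) fe)
        g : Map R′ R
        g = record
          { fn          = inv
          ; surjective  = λ e → let e′ , fe = total e in e′ , inv-f fe
          ; preserves-↓ = lifts⇒preserves R′ R inv λ {d} {e′} → λ where
              refl d≤e → let d′ , fd = total d
                         in d′ , mono fd (proj₂ (f.surjective e′)) d≤e , inv-f fd
          ; commutes    = λ { {e′} refl → S.sym (f.commutes (proj₂ (f.surjective e′))) }
          }
        gf : ∀ e → (f.fn e >>= inv) ≡ just e
        gf e = let e′ , fe = total e in ≡.trans (≡.cong (_>>= inv) fe) (inv-f fe)

module Extremals (em : Classical) (A : GES u u u u) where
  module A = GES A
  open CausalRealisation A.events (𝒞∞ A)
  open Realisation using () renaming (Carrier to ∣_∣)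
  open Lifting

  labels-resp : ∀ {E : Set u} (ρ : E → A.Carrier) (x : Pred E u) → labels ρ x Respects A._≈_
  labels-resp ρ x s≈t (e , xe , ρe≈s) = e , xe , A.trans ρe≈s s≈t

  labels-mono : ∀ {E : Set u} {ρ : E → A.Carrier} {x y : Pred E u} → x ⊑ y → labels ρ x ⊑ labels ρ y
  labels-mono x⊑y (e , xe , eq) = e , x⊑y xe , eq

  ↓-down : ∀ (R : Realisation) e → let open Realisation R in DownClosed _≤_ (_≤ e)
  ↓-down R e = Realisation.≤-trans R

  whole : ∀ (R : Realisation) → 𝒞∞ A (labels (Realisation.ρ R) (λ _ → Lift u ⊤))
  whole R = Realisation.realises R (λ _ _ → _)

  -- Subtypes with irrelevant membership proofs.

  Sub : {E : Set u} → Pred E u → Set u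
  Sub {E} P = Σ E λ e → True (em {P = P e})

  module _ {E : Set u} {P : Pred E u} where
    member : (s : Sub P) → P (proj₁ s)
    member (_ , t) = toWitness t

    sub : ∀ {e} → P e → Sub P
    sub {e} pe = e , fromWitness pe

    Sub-≡ : {s t : Sub P} → proj₁ s ≡ proj₁ t → s ≡ t
    Sub-≡ {_ , p} {_ , q} refl = ≡.cong (_ ,_) (T-irrelevant p q)

    private
      pick : ∀ e → Dec (P e) → Maybe (Sub P)
      pick e (yes pe) = just (sub pe)
      pick e (no _)   = nothing

    toSub : E → Maybe (Sub P)
    toSub e = pick e em

    toSub-member : (s : Sub P) → toSub (proj₁ s) ≡ just s
    toSub-member s with em {P = P (proj₁ s)} in eq
    ... | yes pe = ≡.cong just (Sub-≡ refl)
    ... | no ¬pe = contradiction (member s) ¬pe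

    toSub-just : ∀ {e s} → toSub e ≡ just s → proj₁ s ≡ e
    toSub-just {e} eq with em {P = P e}
    toSub-just refl | yes _ = refl

  module Restriction (R : Realisation) (top : ∣ R ∣) where
    open Realisation R

    Lo : Set u
    Lo = Sub (_≤ top)

    restrict : Realisation
    restrict = record
      { Carrier        = Lo
      ; _≤_            = λ s t → proj₁ s ≤ proj₁ t
      ; isPartialOrder = record
        { isPreorder = record
          { isEquivalence = ≡.isEquivalence
          ; reflexive     = λ { refl → ≤-refl }
          ; trans         = ≤-trans
          }
        ; antisym = λ s≤t t≤s → Sub-≡ (antisym s≤t t≤s)
        }
      ; ↓-finite       = λ s → Finite-resp-≐
          ( (λ (d , d≤s , eq) → ≡.subst (_≤ proj₁ s) (≡.sym (toSub-just eq)) d≤s)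
          , (λ {t} t≤s → proj₁ t , t≤s , toSub-member t) )
          (Finite-image toSub (↓-finite (proj₁ s)))
      ; ρ              = ρ ∘ proj₁
      ; realises       = λ {x} x↓ → A.IsConfiguration-resp-≐
          ( (λ (d , (s , xs , s≡d) , eq) → s , xs , A.trans (A.reflexive (≡.cong ρ s≡d)) eq)
          , (λ (s , xs , eq) → proj₁ s , (s , xs , refl) , eq) )
          (realises {λ d → ∃ λ s → x s × proj₁ s ≡ d} λ where
            d≤e (s , xs , refl) → let t = sub (≤-trans d≤e (member s)) in t , x↓ d≤e xs , refl)
      }

    restriction : Map R restrict
    restriction = record
      { fn          = toSub
      ; surjective  = λ s → proj₁ s , toSub-member s
      ; preserves-↓ = lifts⇒preserves R restrict toSub λ {t} eq t≤s →
          proj₁ t , ≡.subst (proj₁ t ≤_) (toSub-just eq) t≤s , toSub-member t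
      ; commutes    = λ eq → A.reflexive (≡.cong ρ (≡.sym (toSub-just eq)))
      }

    -- Given a total map g out of the restriction, glue its codomain to the
    -- rest of R.

    module Glue (R′ : Realisation) (g : Map restrict R′) (g-total : Map.Total g) where
      private
        module R′ = Realisation R′
        module g  = Map g

      Hi : Set u
      Hi = Sub (λ e → ¬ e ≤ top)

      data View : Pred Carrier u where
        lo : (s : Lo) → View (proj₁ s)
        hi : (t : Hi) → View (proj₁ t)

      view : ∀ e → View e
      view e with em {P = e ≤ top}
      ... | yes e≤ = lo (sub e≤)
      ... | no e≰  = hi (sub e≰)

      fromView : ∀ {e} → View e → R′.Carrier ⊎ Hi
      fromView (lo s) = inj₁ (proj₁ (g-total s))
      fromView (hi t) = inj₂ t

      G : Carrier → R′.Carrier ⊎ Hi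
      G e = fromView (view e)

      fromView-lo : ∀ {e} (v : View e) (s : Lo) → proj₁ s ≡ e → ∀ {a} → g.fn s ≡ just a →
                    fromView v ≡ inj₁ a
      fromView-lo (lo s′) s eq gs with Sub-≡ {s = s} {t = s′} eq
      ... | refl = ≡.cong inj₁ (just-injective (≡.trans (≡.sym (proj₂ (g-total s))) gs))
      fromView-lo (hi t) s refl gs = contradiction (member s) (member t)

      G-lo : ∀ (s : Lo) {a} → g.fn s ≡ just a → G (proj₁ s) ≡ inj₁ a
      G-lo s = fromView-lo (view (proj₁ s)) s refl

      fromView-hi : ∀ {e} (v : View e) (t : Hi) → proj₁ t ≡ e → fromView v ≡ inj₂ t
      fromView-hi (lo s) t refl = contradiction (member s) (member t)
      fromView-hi (hi t′) t eq  = ≡.cong inj₂ (≡.sym (Sub-≡ eq))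

      G-hi : ∀ t → G (proj₁ t) ≡ inj₂ t
      G-hi t = fromView-hi (view (proj₁ t)) t refl

      infix 4 _⊴_

      _⊴_ : Rel (R′.Carrier ⊎ Hi) u
      inj₁ a ⊴ inj₁ b = a R′.≤ b
      inj₁ a ⊴ inj₂ t = ∃ λ s → proj₁ s ≤ proj₁ t × g.fn s ≡ just a
      inj₂ _ ⊴ inj₁ _ = ⊥
      inj₂ s ⊴ inj₂ t = proj₁ s ≤ proj₁ t

      ⊴-refl : ∀ {v} → v ⊴ v
      ⊴-refl {inj₁ _} = R′.≤-refl
      ⊴-refl {inj₂ _} = ≤-refl

      ⊴-trans : ∀ {v w z} → v ⊴ w → w ⊴ z → v ⊴ z
      ⊴-trans {inj₁ _} {inj₁ _} {inj₁ _} p q = R′.≤-trans p q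
      ⊴-trans {inj₁ _} {inj₁ _} {inj₂ _} p (s , s≤ , gs) =
        let s′ , s′≤s , gs′ = lifts g gs p in s′ , ≤-trans s′≤s s≤ , gs′
      ⊴-trans {inj₁ _} {inj₂ _} {inj₂ _} (s , s≤ , gs) q = s , ≤-trans s≤ q , gs
      ⊴-trans {inj₂ _} {inj₂ _} {inj₂ _} p q = ≤-trans p q

      ⊴-antisym : ∀ {v w} → v ⊴ w → w ⊴ v → v ≡ w
      ⊴-antisym {inj₁ _} {inj₁ _} p q = ≡.cong inj₁ (R′.antisym p q)
      ⊴-antisym {inj₂ _} {inj₂ _} p q = ≡.cong inj₂ (Sub-≡ (antisym p q))

      ρ⊎ : R′.Carrier ⊎ Hi → A.Carrier
      ρ⊎ (inj₁ a) = R′.ρ a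
      ρ⊎ (inj₂ t) = ρ (proj₁ t)

      G-ρ : ∀ e → ρ e A.≈ ρ⊎ (G e)
      G-ρ e with view e
      ... | lo s = g.commutes (proj₂ (g-total s))
      ... | hi _ = A.refl

      G-below : ∀ {e} (t : Hi) → e ≤ proj₁ t → G e ⊴ inj₂ t
      G-below {e} t e≤t with view e
      ... | lo s = s , e≤t , proj₂ (g-total s)
      ... | hi _ = e≤t

      G-lifts : ∀ e {v} → v ⊴ G e → ∃ λ d → d ≤ e × G d ≡ v
      G-lifts e v⊴ with view e
      G-lifts .(proj₁ s) {inj₁ a} a≤ | lo s =
        let s′ , s′≤s , gs′ = lifts g (proj₂ (g-total s)) a≤ in proj₁ s′ , s′≤s , G-lo s′ gs′
      G-lifts .(proj₁ t) {inj₁ a} (s , s≤t , gs) | hi t = proj₁ s , s≤t , G-lo s gs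
      G-lifts .(proj₁ t) {inj₂ t′} t′≤t | hi t = proj₁ t′ , t′≤t , G-hi t′

      G-surjective : ∀ v → ∃ λ e → G e ≡ v
      G-surjective (inj₁ a) = let s , gs = g.surjective a in proj₁ s , G-lo s gs
      G-surjective (inj₂ t) = proj₁ t , G-hi t

      ⊴-finite : ∀ v → Finite (_⊴ v)
      ⊴-finite (inj₁ a) = Finite-resp-≐
        ( (λ { (_ , b≤a , refl) → b≤a })
        , (λ { {inj₁ b} b≤a → b , b≤a , refl ; {inj₂ _} () }) )
        (Finite-image (just ∘ inj₁) (R′.↓-finite a))
      ⊴-finite (inj₂ t) = Finite-resp-≐
        ( (λ { (_ , e≤t , refl) → G-below t e≤t })
        , (λ {v} v⊴t → let d , d≤t , Gd = G-lifts (proj₁ t) (≡.subst (v ⊴_) (≡.sym (G-hi t)) v⊴t)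
                       in d , d≤t , ≡.cong just Gd) )
        (Finite-image (just ∘ G) (↓-finite (proj₁ t)))

      glue-realises : ∀ {x} → DownClosed _⊴_ x → 𝒞∞ A (labels ρ⊎ x)
      glue-realises {x} x↓ = A.compatible-union (labels-resp ρ⊎ x) (whole R)
        (λ (v , _ , eq) → let e , Ge = G-surjective v in
          e , _ , A.trans (G-ρ e) (A.trans (A.reflexive (≡.cong ρ⊎ Ge)) eq))
        λ where
          (inj₁ a , xa , eq) →
            labels R′.ρ (x ∘ inj₁) , R′.realises x↓ ,
            (λ (b , xb , eq) → inj₁ b , xb , eq) , a , xa , eq
          (inj₂ t , xt , eq) →
            labels ρ (_≤ proj₁ t) , realises (↓-down R (proj₁ t)) ,
            (λ (e , e≤t , eq) → G e , x↓ (G-below t e≤t) xt , A.trans (A.sym (G-ρ e)) eq) ,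
            proj₁ t , ≤-refl , eq

      glued : Realisation
      glued = record
        { Carrier        = R′.Carrier ⊎ Hi
        ; _≤_            = _⊴_
        ; isPartialOrder = record
          { isPreorder = record
            { isEquivalence = ≡.isEquivalence
            ; reflexive     = λ { {v} refl → ⊴-refl {v} }
            ; trans         = λ {v} {w} {z} → ⊴-trans {v} {w} {z}
            }
          ; antisym = ⊴-antisym
          }
        ; ↓-finite       = ⊴-finite
        ; ρ              = ρ⊎
        ; realises       = glue-realises
        }

      glueMap : Map R glued
      glueMap = record
        { fn          = just ∘ G
        ; surjective  = λ v → let e , Ge = G-surjective v in e , ≡.cong just Ge
        ; preserves-↓ = lifts⇒preserves R glued (just ∘ G) λ
            { {e = e} refl v⊴ → let d , d≤e , Gd = G-lifts e v⊴ in d , d≤e , ≡.cong just Gd }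
        ; commutes    = λ { {e} refl → G-ρ e }
        }

      glue-iso⇒iso : IsIso glueMap → IsIso g
      glue-iso⇒iso iso = mk-iso g g-total
        (λ {s} {t} gs gt → Sub-≡ (iso⇒injective glueMap iso
          (≡.cong just (G-lo s gs)) (≡.cong just (G-lo t gt))))
        (λ {s} {t} gs gt s≤t → iso⇒monotone glueMap iso
          (≡.cong just (G-lo s gs)) (≡.cong just (G-lo t gt)) s≤t)

    restrict-extremal : Extremal R → Extremal restrict
    restrict-extremal ext {R′} g g-total = glue-iso⇒iso (ext glueMap (λ e → G e , refl))
      where open Glue R′ g g-total

  -- The domain of a map out of an extremal realisation is down-closed.

  module Domain (R : Realisation) (ext : Extremal R) (R′ : Realisation) (f : Map R R′) where
    open Realisation R
    private
      module R′ = Realisation R′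
      module f  = Map f

    Defined : Pred Carrier u
    Defined e = ∃ λ e′ → f.fn e ≡ just e′

    infix 4 _⊴_

    _⊴_ : Rel Carrier u
    d ⊴ e = d ≤ e × (Defined e → Defined d)

    reordered : Realisation
    reordered = record
      { Carrier        = Carrier
      ; _≤_            = _⊴_
      ; isPartialOrder = record
        { isPreorder = record
          { isEquivalence = ≡.isEquivalence
          ; reflexive     = λ { refl → ≤-refl , id }
          ; trans         = λ (p , p′) (q , q′) → ≤-trans p q , p′ ∘ q′
          }
        ; antisym = λ p q → antisym (proj₁ p) (proj₁ q)
        }
      ; ↓-finite       = λ e → Finite-⊆ em proj₁ (↓-finite e)
      ; ρ              = ρ
      ; realises       = λ {x} x↓ → A.compatible-union (labels-resp ρ x) (whole R)
          (labels-mono _) λ (e , xe , eq) → cover x↓ xe eq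
      }
      where
        cover : ∀ {x e s} → DownClosed _⊴_ x → x e → ρ e A.≈ s →
                ∃ λ w → 𝒞∞ A w × w ⊑ labels ρ x × w s
        cover {x} {e} x↓ xe eq with f.fn e in fe
        ... | just e′ =
          labels R′.ρ (image f.fn x) ,
          R′.realises (λ d′≤ (c , xc , fc) → let d , d≤c , fd = lifts f fc d′≤
                                             in d , x↓ (d≤c , λ _ → _ , fd) xc , fd) ,
          (λ (_ , (c , xc , fc) , eq) → c , xc , A.trans (f.commutes fc) eq) ,
          e′ , (e , xe , fe) , A.trans (A.sym (f.commutes fe)) eq
        ... | nothing =
          labels ρ (_≤ e) , realises (↓-down R e) ,
          labels-mono (λ c≤e → x↓ (c≤e , λ (_ , fe′) → case ≡.trans (≡.sym fe) fe′ of λ ()) xe) ,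
          e , ≤-refl , eq

    idMap : Map R reordered
    idMap = record
      { fn          = just
      ; surjective  = λ e → e , refl
      ; preserves-↓ = lifts⇒preserves R reordered just λ { refl d≤e → _ , proj₁ d≤e , refl }
      ; commutes    = λ { refl → A.refl }
      }

    domain-↓ : DownClosed _≤_ Defined
    domain-↓ d≤e = proj₂ (iso⇒monotone idMap (ext idMap (λ e → e , refl)) refl refl d≤e)

  ↓ₜ : (R : TopExtremal) → TopExtremal.Carrier R → TopExtremal
  ↓ₜ R e = record
    { realisation = restrict
    ; extremal    = restrict-extremal R.extremal
    ; top         = sub R.≤-refl
    ; ≤-top       = member
    }
    where
      module R = TopExtremal R
      open Restriction R.realisation e

  -- Whatever lies ⪯-below R is isomorphic to the restriction of R to some ↓ e.

  below-≅ : (R R′ : TopExtremal) → Map (TopExtremal.realisation R) (TopExtremal.realisation R′) →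
            ∃ λ e → TopExtremal.realisation (↓ₜ R e) ≅ TopExtremal.realisation R′
  below-≅ R R′ f = e , g , restrict-extremal R.extremal g g-total
    where
      module R  = TopExtremal R
      module R′ = TopExtremal R′
      module f  = Map f
      e = proj₁ (f.surjective R′.top)
      fe = proj₂ (f.surjective R′.top)
      open Restriction R.realisation e
      open Domain R.realisation R.extremal R′.realisation f

      g : Map restrict R′.realisation
      g = record
        { fn          = f.fn ∘ proj₁
        ; surjective  = λ d′ → let d , d≤e , fd = lifts f fe (R′.≤-top d′) in sub d≤e , fd
        ; preserves-↓ = lifts⇒preserves restrict R′.realisation (f.fn ∘ proj₁) λ {_} {s} fs d′≤ →
            let d , d≤s , fd = lifts f fs d′≤ in sub (R.≤-trans d≤s (member s)) , d≤s , fd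
        ; commutes    = f.commutes
        }

      g-total : Map.Total g
      g-total s = domain-↓ (member s) (_ , fe)

  top-≅ : (R R′ : TopExtremal) → TopExtremal.realisation R ≅ TopExtremal.realisation R′ →
          TopExtremal.ρ R (TopExtremal.top R) A.≈ TopExtremal.ρ R′ (TopExtremal.top R′)
  top-≅ R R′ (f , iso) =
    let e , fe = Map.surjective f R′.top
        b , fb = iso⇒total f iso R.top
        b≡top = R′.antisym (R′.≤-top b) (iso⇒monotone f iso fe fb (R.≤-top e))
    in A.trans (Map.commutes f fb) (A.reflexive (≡.cong R′.ρ b≡top))
    where
      module R  = TopExtremal R
      module R′ = TopExtremal R′

  ⪯-antisym : (R R′ : TopExtremal) →
              TopExtremal.realisation R ⪯ TopExtremal.realisation R′ →
              TopExtremal.realisation R′ ⪯ TopExtremal.realisation R →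
              TopExtremal.realisation R ≅ TopExtremal.realisation R′
  ⪯-antisym R R′ f g = ≅-sym (f , R′.extremal f f-total)
    where
      module R  = TopExtremal R
      module R′ = TopExtremal R′
      k : Map R′.realisation R′.realisation
      k = ⪯-trans g f
      k-total : ∀ e → Map.fn k e ≢ nothing
      k-total = surjection-total em
        (Finite-resp-≐ ((λ _ → _) , (λ _ → R′.≤-top _)) (R′.↓-finite R′.top))
        (Map.fn k) (Map.surjective k)
      f-total : Map.Total f
      f-total e with Map.fn f e in eq
      ... | just e′ = e′ , refl
      ... | nothing = contradiction (≡.cong (_>>= Map.fn g) eq) (k-total e)

Choice : GES u u u u → ∀ p → Set (lsuc (u ⊔ p))
Choice A p = CausalRealisation.Representatives (GES.events A) (𝒞∞ A) p

module _ (em : Classical) (A : GES u u u u) (choice : Choice A p) where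
  private
    module A = GES A
    open CausalRealisation A.events (𝒞∞ A)
    open Representatives choice
    open Extremals em A using (↓ₜ; below-≅; ⪯-antisym; top-≅; whole; module Restriction)

    module rep i = TopExtremal (rep i)

  max : Index → A.Carrier
  max i = rep.ρ i (rep.top i)

  -- max[X] for a finite set X, where [X] is its down-closure.

  max↓ : List Index → Pred A.Carrier _
  max↓ X s = ∃ λ i → (∃ λ j → j ∈ X × rep.realisation i ⪯ rep.realisation j) × max i A.≈ s

  private
    max↓-resp : ∀ X → max↓ X Respects A._≈_
    max↓-resp X s≈t (i , i≤ , eq) = i , i≤ , A.trans eq s≈t

    max↓-⊆ : ∀ {X Y} → X ⊆ Y → max↓ X ⊑ max↓ Y
    max↓-⊆ X⊆Y (i , (j , j∈ , i≤j) , eq) = i , (j , X⊆Y j∈ , i≤j) , eq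

    max↓-singleton : ∀ i → A.IsConfiguration (max↓ [ i ])
    max↓-singleton i = A.IsConfiguration-resp-≐
      ( (λ (e , _ , eq) →
          let j , ↓e≅j = complete (↓ₜ (rep i) e)
              open Restriction (rep.realisation i) e
          in j , (i , here refl , ⪯-trans (proj₁ ↓e≅j) restriction) ,
             A.trans (A.sym (top-≅ (↓ₜ (rep i) e) (rep j) ↓e≅j)) eq)
      , (λ { (j , (_ , here refl , f) , eq) →
          let e , fe = Map.surjective f (rep.top j)
          in e , _ , A.trans (Map.commutes f fe) eq }) )
      (whole (rep.realisation i))

    er-finite : ∀ i → Finite (λ j → rep.realisation j ⪯ rep.realisation i)
    er-finite i =
      map below (proj₁ (rep.↓-finite i (rep.top i))) ,
      (λ {j} f →
        let e , ↓e≅j = below-≅ (rep i) (rep j) f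
            k≡j = unique (⪯-antisym (rep (below e)) (rep j)
                    (⪯-trans (proj₁ (below-iso e)) (proj₁ (≅-sym ↓e≅j)))
                    (⪯-trans (proj₁ ↓e≅j) (proj₁ (≅-sym (below-iso e)))))
        in ≡.subst (_∈ _) k≡j
             (∈-map⁺ below (proj₁ (proj₂ (rep.↓-finite i (rep.top i))) (rep.≤-top i e)))) ,
      (λ j∈ → case ∈-map⁻ below j∈ of λ
        { (e , _ , refl) → ⪯-trans (proj₁ (below-iso e)) (Restriction.restriction (rep.realisation i) e) })
      where
        below : rep.Carrier i → Index
        below e = proj₁ (complete (↓ₜ (rep i) e))
        below-iso : ∀ e → TopExtremal.realisation (↓ₜ (rep i) e) ≅ rep.realisation (below e)
        below-iso e = proj₂ (complete (↓ₜ (rep i) e))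

    er-Con-⊆ : ∀ {X Y} → X ⊆ Y → A.IsConfiguration (max↓ Y) → A.IsConfiguration (max↓ X)
    er-Con-⊆ {X} X⊆Y cY = A.compatible-union (max↓-resp X) cY (max↓-⊆ X⊆Y)
      λ (i , (j , j∈ , i≤j) , eq) →
        max↓ [ j ] , max↓-singleton j , max↓-⊆ (λ { (here refl) → j∈ }) , i , (j , here refl , i≤j) , eq

    er-Con-↓ : ∀ {X i j} → A.IsConfiguration (max↓ X) → rep.realisation i ⪯ rep.realisation j → j ∈ X →
               A.IsConfiguration (max↓ (i ∷ X))
    er-Con-↓ {X} cX i≤j j∈ = A.IsConfiguration-resp-≐
      ( max↓-⊆ there
      , (λ { (k , (_ , here refl , k≤i) , eq) → k , (_ , j∈ , ⪯-trans k≤i i≤j) , eq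
           ; (k , (l , there l∈ , k≤l) , eq)  → k , (l , l∈ , k≤l) , eq }) )
      cX

    er-Con-[] : A.IsConfiguration (max↓ [])
    er-Con-[] = record
      { resp       = max↓-resp []
      ; consistent = λ { [] → A.Con-⊆ (λ ()) (proj₂ A.Con-nonempty)
                       ; ((_ , (_ , () , _) , _) ∷ _) }
      ; secured    = λ { (_ , (_ , () , _) , _) }
      }

  er : ESE p (lsuc u) (lsuc u ⊔ p) u
  er = record
    { eventStructure = record
      { Carrier        = Index
      ; _≤_            = λ i j → rep.realisation i ⪯ rep.realisation j
      ; Con            = λ X → A.IsConfiguration (max↓ X)
      ; isPartialOrder = record
        { isPreorder = record
          { isEquivalence = ≡.isEquivalence
          ; reflexive     = λ { refl → ⪯-refl }
          ; trans         = ⪯-trans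
          }
        ; antisym = λ {i} {j} i≤j j≤i → unique (⪯-antisym (rep i) (rep j) i≤j j≤i)
        }
      ; ↓-finite       = er-finite
      ; Con-nonempty   = [] , er-Con-[]
      ; Con-singleton  = max↓-singleton
      ; Con-⊆          = er-Con-⊆
      ; Con-↓          = er-Con-↓
      }
    ; _~_           = λ i j → max i A.≈ max j
    ; isEquivalence = record { refl = A.refl ; sym = A.sym ; trans = A.trans }
    }

  private
    module er  = ESE er
    module ger = GES (ges er)

    max-cong : Congruent ger.events A.events (just ∘ max)
    max-cong i~j = Pointwise.just i~j

    max-Con : ∀ {X} → ger.Con X → A.Con (mapMaybe (just ∘ max) X)
    max-Con {X} (Y , Y∈ , X⊆Y , _) = A.IsConfiguration.consistent Y∈ (All.tabulate λ s∈ →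
      let i , i∈ , eq = ∈-mapMaybe⁻ (just ∘ max) X s∈
          j , j∈ , i~j = find er.~-setoid (X⊆Y (Any.map er.~-reflexive i∈))
      in j , (j , j∈ , ⪯-refl) , A.trans (A.sym i~j) (A.reflexive (just-injective eq)))

    -- Cut a securing chain for s at the first occurrence of s.

    cut : ∀ {x : Pred A.Carrier ℓ} {es} s → A.Chain x es → s A.∈ₛ es →
          ∃ λ ds → All x ds × ¬ s A.∈ₛ ds × ds A.⊢ s
    cut s (A._▹_ {es} {e} ch (xe , ⊢e)) s∈ with em {P = s A.∈ₛ es}
    ... | yes s∈′ = cut s ch s∈′
    ... | no s∉ with s∈
    ...   | here s≈e  = es , all ch , s∉ , A.⊢-resp (A.sym s≈e) ⊢e
      where
        all : ∀ {x : Pred A.Carrier ℓ} {es} → A.Chain x es → All x es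
        all A.[] = []
        all (ch A.▹ (xe , _)) = xe ∷ all ch
    ...   | there s∈′ = contradiction s∈′ s∉

    max-⊢ : ∀ {X i s} → X ger.⊢ i → just (max i) ≡ just s → mapMaybe (just ∘ max) X A.⊢ s
    max-⊢ {X} {i} (X∈ , p , i~p , ↓p) refl =
      let es , ch = A.IsConfiguration.secured (max↓-singleton p)
                      (p , (p , here refl , ⪯-refl) , A.refl)
          ds , ds⊆ , p∉ , ⊢p = cut (max p) ch (here A.refl)
      in A.⊢-resp (A.sym i~p) (A.⊢-mono (max-Con X∈) (λ t∈ → inside ds⊆ p∉ t∈) ⊢p)
      where
        inside : ∀ {ds t} → All (max↓ [ p ]) ds → ¬ max p A.∈ₛ ds → t A.∈ₛ ds →
                 t A.∈ₛ mapMaybe (just ∘ max) X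
        inside {ds} ds⊆ p∉ t∈ with find A.events t∈
        ... | t′ , t′∈ , t≈t′ with All.lookup ds⊆ t′∈
        ... | j , (_ , here refl , j≤p) , j≈t′ with ↓p j≤p
        ... | here j~i  = contradiction
          (Any.map (λ { refl → A.trans (A.sym (A.trans j~i i~p)) j≈t′ }) t′∈) p∉
        ... | there j∈X = SetoidMembershipₚ.∈-resp-≈ A.events (A.trans j≈t′ (A.sym t≈t′))
          (∈-mapMaybe⁺ₛ ger.events A.events max-cong X j∈X refl)

  maxMap : GESMap (ges er) A
  maxMap = record
    { fn            = just ∘ max
    ; cong          = max-cong
    ; preserves-Con = max-Con
    ; injective     = λ { _ _ _ refl refl i~j → i~j }
    ; preserves-⊢   = max-⊢
    }

{-# OPTIONS --safe #-}

-- Since max is injective on ≡-classes of er(A), any h with f = max ∘ ges(h) is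
-- determined up to ≡ by f; only existence needs work.  Define h q by recursion
-- on q ∈ Q.  With D = { h r | r < q } already a down-closed set of events,
-- choose a down-closed xs ⊆ D of least size such that max[xs] ∪ {f q} is a
-- configuration of A, and let h q be the representative of xs with a new top
-- element labelled f q.  This realisation is extremal: on xs a total map out of
-- it is an order embedding, because every ↓ i is isomorphic to the extremal
-- rep i; and minimality of xs forces the new top to stay above all of xs and
-- to be identified with none of its elements.

module Submission where

open import Level using (Level; Lift; lift; _⊔_) renaming (suc to lsuc)
open import Data.Empty.Polymorphic using (⊥)
open import Data.Fin.Base using (Fin; zero; suc)
open import Data.List.Base
  using (List; []; _∷_; [_]; _++_; length; map; mapMaybe; filter; deduplicate; lookup; allFin)
open import Data.List.Membership.Propositional using (_∈_)
open import Data.List.Membership.Propositional.Properties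
  using (∈-map⁺; ∈-filter⁺; ∈-filter⁻; ∈-++⁺ˡ; ∈-++⁺ʳ; ∈-map⁻; ∈-lookup; ∈-allFin;
         ∈-deduplicate⁺; ∈-deduplicate⁻)
open import Data.List.Properties using (filter-notAll; mapMaybe-cong)
open import Data.List.Relation.Binary.Subset.Propositional using (_⊆_)
open import Data.List.Relation.Unary.All as All using (All; []; _∷_)
import Data.List.Relation.Unary.All.Properties as Allₚ
open import Data.List.Relation.Unary.AllPairs using ([]; _∷_)
open import Data.List.Relation.Unary.Any as Any using (Any; here; there)
open import Data.List.Relation.Unary.Any.Properties using (lookup-index)
open import Data.List.Relation.Unary.Unique.Propositional using (Unique)
open import Data.List.Relation.Unary.Unique.DecPropositional.Properties using (deduplicate-!)
import Data.List.Relation.Unary.Unique.Propositional.Properties as Unique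
open import Data.Maybe.Base as Maybe using (Maybe; just; nothing; _>>=_)
open import Data.Maybe.Properties using (just-injective)
open import Data.Maybe.Relation.Binary.Pointwise as Pointwise using (Pointwise)
open import Data.Nat.Base as ℕ using (ℕ)
open import Data.Nat.Induction using (<-wellFounded)
import Data.Nat.Properties as ℕₚ
open import Data.Product.Base using (∃; _×_; _,_; proj₁; proj₂)
open import Data.Sum.Base as Sum using (_⊎_; inj₁; inj₂)
open import Data.Unit.Base using (⊤)
open import Function.Base using (_∘_; id; case_of_)
open import Induction.WellFounded as WF
  using (Acc; acc; WellFounded; WfRec; module FixPoint; module Subrelation)
import Relation.Binary.Construct.On as On
open import Relation.Binary.Core using (Rel)
open import Relation.Binary.PropositionalEquality as ≡ using (_≡_; _≢_; refl)
open import Relation.Nullary.Decidable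
  using (Dec; yes; no; True; toWitness; fromWitness; dec⇒maybe)
open import Relation.Nullary.Negation using (¬_; contradiction)
open import Relation.Unary using (Pred) renaming (_⊆_ to _⊑_)
open import Defs
open PartialFunctions

private
  variable
    a b c ℓ ℓ′ ℓ₁ ℓ₂ ℓ₃ ℓ₄ u p : Level

-- Minimal elements and lists without repetition

minimal : Classical → {B : Set b} (size : B → ℕ) {P : Pred B ℓ} → ∃ P →
          ∃ λ x → P x × (∀ {y} → P y → size x ℕ.≤ size y)
minimal em size {P} (x , px) = go x px (<-wellFounded (size x))
  where
    go : ∀ x → P x → Acc ℕ._<_ (size x) → ∃ λ x → P x × (∀ {y} → P y → size x ℕ.≤ size y)
    go x px (acc rs) with em {P = ∃ λ y → P y × size y ℕ.< size x}
    ... | yes (y , py , y<x) = go y py (rs y<x)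
    ... | no none            = x , px , λ py → ℕₚ.≮⇒≥ λ y<x → none (_ , py , y<x)

Unique⇒lookup-injective : {A : Set a} {xs : List A} → Unique xs →
                          ∀ {k l} → lookup xs k ≡ lookup xs l → k ≡ l
Unique⇒lookup-injective (_ ∷ _)  {zero}  {zero}  _  = refl
Unique⇒lookup-injective (x≢ ∷ _) {zero}  {suc l} eq = contradiction eq (All.lookup x≢ (∈-lookup l))
Unique⇒lookup-injective (x≢ ∷ _) {suc k} {zero}  eq = contradiction (≡.sym eq) (All.lookup x≢ (∈-lookup k))
Unique⇒lookup-injective (_ ∷ uq) {suc k} {suc l} eq = ≡.cong suc (Unique⇒lookup-injective uq eq)

-- Securing chains in a general event structure

module Chains (A : GES c ℓ ℓ₁ ℓ₂) where
  open GES A hiding (refl; sym; trans)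

  Chain-mono : {x : Pred Carrier a} {y : Pred Carrier b} → x ⊑ y → Chain x ⊑ Chain y
  Chain-mono x⊑y []               = []
  Chain-mono x⊑y (es ▹ (xe , ⊢e)) = Chain-mono x⊑y es ▹ (x⊑y xe , ⊢e)

  module _ {z : Pred Carrier ℓ′} (z-Con : ∀ {X} → All z X → Con X) where

    Chain⇒All : ∀ {es} → Chain z es → All z es
    Chain⇒All []              = []
    Chain⇒All (ch ▹ (ze , _)) = ze ∷ Chain⇒All ch

    -- The events of `ds` come first. Each enabling in `es` survives the larger history by `⊢-mono`,
    -- since that history lies in `z` and is therefore consistent.
    Chain-++ : ∀ {es ds} → Chain z es → Chain z ds → Chain z (es ++ ds)
    Chain-++ []               ds = ds
    Chain-++ (_▹_ {es} es′ (ze , ⊢e)) ds = ch ▹ (ze , ⊢-mono (z-Con (Chain⇒All ch)) left ⊢e)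
      where
        ch = Chain-++ es′ ds
        left : ∀ {es ds} → es ⊆ₛ es ++ ds
        left (here eq)  = here eq
        left (there e∈) = there (left e∈)

    Chain-⊇ : ∀ {xs} → All (λ e → ∃ λ es → Chain z (e ∷ es)) xs → ∃ λ es → Chain z es × xs ⊆ es
    Chain-⊇ [] = [] , [] , λ ()
    Chain-⊇ {x ∷ xs} ((es , ch) ∷ chs) =
      let es′ , ch′ , xs⊆ = Chain-⊇ chs
      in x ∷ es ++ es′ , Chain-++ ch ch′ ,
         λ { (here refl) → here refl ; (there y∈) → ∈-++⁺ʳ (x ∷ es) (xs⊆ y∈) }

    -- The chains of the members of `xs` join into one chain containing `xs`, to which the enabling
    -- by `xs` weakens.
    secured-⊢ : ∀ {xs e} → All (λ e → ∃ λ es → Chain z (e ∷ es)) xs → xs ⊢ e → z e →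
                ∃ λ es → Chain z (e ∷ es)
    secured-⊢ chs ⊢e ze =
      let es , ch , xs⊆ = Chain-⊇ chs
      in es , ch ▹ (ze , ⊢-mono (z-Con (Chain⇒All ch)) (⊆⇒⊆ₛ xs⊆) ⊢e)
      where
        ⊆⇒⊆ₛ : ∀ {X Y} → X ⊆ Y → X ⊆ₛ Y
        ⊆⇒⊆ₛ X⊆Y e∈ = let y , y∈ , e≈y = find events e∈ in Any.map (λ { refl → e≈y }) (X⊆Y y∈)

-- Well-foundedness of the strict causal order

module WellFoundedOrder (em : Classical) (P : EventStructure c ℓ₁ ℓ₂) where
  open EventStructure P

  infix 4 _<_
  _<_ : Rel Carrier (c ⊔ ℓ₁)
  d < e = d ≤ e × d ≢ e

  <-≤-trans : ∀ {d e} → d < e → ∀ {b} → b ≤ d → b < e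
  <-≤-trans (d≤e , d≢e) b≤d = ≤-trans b≤d d≤e , λ { refl → d≢e (antisym d≤e b≤d) }

  ≤⇒≡⊎< : ∀ {d e} → d ≤ e → d ≡ e ⊎ d < e
  ≤⇒≡⊎< {d} {e} d≤e with em {P = d ≡ e}
  ... | yes d≡e = inj₁ d≡e
  ... | no  d≢e = inj₂ (d≤e , d≢e)

  private
    _≟_ : (d e : Carrier) → Dec (d ≡ e)
    _ ≟ _ = em

    ↓-list : Carrier → List Carrier
    ↓-list e = deduplicate _≟_ (proj₁ (↓-finite e))

    ∈↓⁺ : ∀ {d e} → d ≤ e → d ∈ ↓-list e
    ∈↓⁺ {e = e} d≤e = ∈-deduplicate⁺ _≟_ (proj₁ (proj₂ (↓-finite e)) d≤e)

    ∈↓⁻ : ∀ {d e} → d ∈ ↓-list e → d ≤ e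
    ∈↓⁻ {e = e} d∈ = proj₂ (proj₂ (↓-finite e)) (∈-deduplicate⁻ _≟_ (proj₁ (↓-finite e)) d∈)

    -- The list `e ∷ ↓-list d` has no repetition and is contained in `↓-list e`.
    rank-< : ∀ {d e} → d < e → length (↓-list d) ℕ.< length (↓-list e)
    rank-< {d} {e} (d≤e , d≢e) = Unique-length
      (All.tabulate (λ b∈ → λ { refl → d≢e (antisym d≤e (∈↓⁻ b∈)) }) ∷ deduplicate-! _≟_ (proj₁ (↓-finite d)))
      λ { (here refl) → ∈↓⁺ ≤-refl ; (there b∈) → ∈↓⁺ (≤-trans (∈↓⁻ b∈) d≤e) }

  <-wf : WellFounded _<_
  <-wf = Subrelation.wellFounded rank-< (On.wellFounded (length ∘ ↓-list) <-wellFounded)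

  private
    strict : ∀ e → Carrier → Maybe (∃ (_< e))
    strict e d = Maybe.map (d ,_) (dec⇒maybe em)

    strict-just : ∀ {d e} → d < e → ∃ λ d<e → strict e d ≡ just (d , d<e)
    strict-just {d} {e} d<e with em {P = d < e}
    ... | yes q   = q , refl
    ... | no  d≮e = contradiction d<e d≮e

  -- Each predecessor carries its proof of `_< e`, so that a recursive argument of type `WfRec` can
  -- be applied along the list.
  lower : ∀ e → List (∃ (_< e))
  lower e = mapMaybe (strict e) (↓-list e)

  ∈-lower : ∀ {d e} → d < e → ∃ λ d<e → (d , d<e) ∈ lower e
  ∈-lower {e = e} d<e =
    let q , eq = strict-just d<e in q , ∈-mapMaybe⁺ (strict e) (↓-list e) (∈↓⁺ (proj₁ d<e)) eq

-- Maps of event structures with equivalence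

mk-ESEMap : (P : ESE a ℓ₁ ℓ₂ ℓ₃) (Q : ESE b ℓ ℓ′ ℓ₄) →
            let module P = ESE P; module Q = ESE Q in
            (h : P.Carrier → Maybe Q.Carrier) → Congruent P.~-setoid Q.~-setoid h →
            (∀ X → P.IsConfiguration (_∈ X) → DownClosed Q._≤_ (_∈ mapMaybe h X)) →
            (∀ X → P.IsConfiguration (_∈ X) → Q.Con (mapMaybe h X)) →
            (∀ X → P.IsConfiguration (_∈ X) → ∀ {q r i j} → q ∈ X → r ∈ X →
              h q ≡ just i → h r ≡ just j → i Q.~ j → q P.~ r) →
            ESEMap P Q
mk-ESEMap P Q h cong down con reflects = record
  { fn                      = h
  ; preserves-~             = cong
  ; preserves-configuration = λ X cX → record
    { down-closed = down X cX
    -- Consistency of the image itself suffices, since any other list drawn from it is a subset.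
    ; consistent  = λ Y⊆ → ESE.Con-⊆ Q (All.lookup Y⊆) (con X cX)
    }
  ; reflects-~              = reflects
  }

-- Extremal realisations and their principal down-sets

module Realisations (em : Classical) (A : GES u u u u) (choice : Choice A p) where
  private module A = GES A
  open CausalRealisation A.events (𝒞∞ A) public
  open Lifting public
  open Representatives choice public
  open Extremals em A public
    using (↓ₜ; ↓-down; labels-resp; below-≅; ⪯-antisym; top-≅; member; sub; toSub; toSub-member;
           toSub-just; Sub-≡; module Restriction; module Domain)

  module er = ESE (er em A choice)
  module rep i = TopExtremal (rep i)

  mx : Index → A.Carrier
  mx = max em A choice

  -- Maps of realisations need not be monotone, so an element below `e` may be sent outside the
  -- down-set of `e′`; `toSub` discards such values. Surjectivity follows by lifting along `f`.
  restrict-map : ∀ {R R′} (f : Map R R′) {e e′} → Map.fn f e ≡ just e′ →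
                 Map (Restriction.restrict R e) (Restriction.restrict R′ e′)
  restrict-map {R} {R′} f {e} {e′} fe = record
    { fn          = g
    ; surjective  = λ t → let d , d≤e , fd = lifts f fe (member t) in sub d≤e , g-just (sub d≤e) t fd
    ; preserves-↓ = lifts⇒preserves (Restriction.restrict R e) (Restriction.restrict R′ e′) g
        λ {t′} {s} {t} eq t′≤t →
          let c , fs , ct = >>=-just (f.fn (proj₁ s)) eq
              d , d≤s , fd = lifts f fs (≡.subst (proj₁ t′ R′.≤_) (toSub-just ct) t′≤t)
              d≤e = R.≤-trans d≤s (member s)
          in sub d≤e , d≤s , g-just (sub d≤e) t′ fd
    ; commutes    = λ {s} eq →
        let c , fs , ct = >>=-just (f.fn (proj₁ s)) eq
        in A.trans (f.commutes fs) (A.reflexive (≡.cong R′.ρ (≡.sym (toSub-just ct))))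
    }
    where
      module R  = Realisation R
      module R′ = Realisation R′
      module f  = Map f
      g : Restriction.Lo R e → Maybe (Restriction.Lo R′ e′)
      g s = f.fn (proj₁ s) >>= toSub
      g-just : ∀ s t → f.fn (proj₁ s) ≡ just (proj₁ t) → g s ≡ just t
      g-just s t fd = ≡.trans (≡.cong (_>>= toSub) fd) (toSub-member t)

  -- The domain of a map out of an extremal realisation is down-closed, so it is everything once it
  -- contains the top.
  total : (R : TopExtremal) {R′ : Realisation} (f : Map (TopExtremal.realisation R) R′) →
          ∀ {e′} → Map.fn f (TopExtremal.top R) ≡ just e′ → Map.Total f
  total R {R′} f fe e = Domain.domain-↓ (TopExtremal.realisation R) (TopExtremal.extremal R) R′ f
                   (TopExtremal.≤-top R e) (_ , fe)

  -- Abstract, since unfolding it makes conversion checking blow up.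

  abstract
    below : ∀ i → rep.Carrier i → Index
    below i e = proj₁ (complete (↓ₜ (rep i) e))

    ↓≅below : ∀ i e → Restriction.restrict (rep.realisation i) e ≅ rep.realisation (below i e)
    ↓≅below i e = proj₂ (complete (↓ₜ (rep i) e))

  max-below : ∀ i e → rep.ρ i e A.≈ mx (below i e)
  max-below i e = top-≅ (↓ₜ (rep i) e) (rep (below i e)) (↓≅below i e)

  below-≤ : ∀ i e → below i e er.≤ i
  below-≤ i e = ⪯-trans (proj₁ (↓≅below i e)) (Restriction.restriction (rep.realisation i) e)

  below-unique : ∀ i e {j} → Restriction.restrict (rep.realisation i) e ≅ rep.realisation j → below i e ≡ j
  below-unique i e {j} ↓e≅j = er.antisym {below i e} {j}
    (⪯-trans (proj₁ (↓≅below i e)) (proj₁ (≅-sym ↓e≅j)))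
    (⪯-trans (proj₁ ↓e≅j) (proj₁ (≅-sym (↓≅below i e))))

  below-surjective : ∀ {i j} (f : j er.≤ i) → below i (proj₁ (Map.surjective f (rep.top j))) ≡ j
  below-surjective {i} {j} f = below-unique i _ (proj₂ (below-≅ (rep i) (rep j) f))

  -- The witness is a preimage of the top of `rep j` inside the down-set of `e`. The composite `f`
  -- chooses, by computation, the same preimage, so `below-surjective` applies to it.
  below-lifts : ∀ {i j} e → j er.≤ below i e → ∃ λ d → rep._≤_ i d e × below i d ≡ j
  below-lifts {i} {j} e j≤ = proj₁ s , member s , below-surjective {i} {j} f
    where
      g : Map (Restriction.restrict (rep.realisation i) e) (rep.realisation j)
      g = ⪯-trans j≤ (proj₁ (↓≅below i e))
      f : Map (rep.realisation i) (rep.realisation j)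
      f = ⪯-trans g (Restriction.restriction (rep.realisation i) e)
      s = proj₁ (Map.surjective g (rep.top j))

  -- Least candidates and the realisation with a new top

  cone : A.Carrier → List Index → Pred A.Carrier _
  cone a xs s = (∃ λ i → i ∈ xs × mx i A.≈ s) ⊎ a A.≈ s

  -- With `xs` down-closed, the cone is `max[xs] ∪ {a}`. The absence of repetition makes `length`
  -- the cardinality and lets positions in `xs` stand for its members.
  record Candidate (a : A.Carrier) (xs : List Index) : Set (p ⊔ lsuc u) where
    field
      xs-unique     : Unique xs
      xs-↓          : DownClosed er._≤_ (_∈ xs)
      configuration : A.IsConfiguration (cone a xs)

  module Apex {a xs} (candidate : Candidate a xs)
              (least : ∀ {ys} → ys ⊆ xs → Candidate a ys → length xs ℕ.≤ length ys) where
    open Candidate candidate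

    -- If a member of `xs` failed `P`, filtering would give a strictly shorter candidate. Minimality
    -- of `xs` is always used in this form.
    filter-all : {P : Pred Index ℓ} → Candidate a (filter (λ i → em {P = P i}) xs) → ∀ {i} → i ∈ xs → P i
    filter-all {P = P} cand {i} i∈ with em {P = P i}
    ... | yes pi = pi
    ... | no ¬pi = contradiction
      (least (λ j∈ → proj₁ (∈-filter⁻ (λ i → em {P = P i}) {xs = xs} j∈)) cand)
      (ℕₚ.<⇒≱ (filter-notAll (λ i → em {P = P i}) xs (Any.map (λ { refl → ¬pi }) i∈)))

    -- Otherwise the indices strictly below `i` would form a candidate, its cone being the
    -- configuration `max[i]`; minimality would put `i` strictly below itself.
    a-fresh : ∀ {i} → i ∈ xs → ¬ mx i A.≈ a
    a-fresh {i} i∈ i≈a = proj₂ (filter-all {P = λ j → j er.≤ i × j ≢ i} record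
      { xs-unique     = Unique.filter⁺ P? xs-unique
      ; xs-↓          = λ {j} {k} j≤k k∈ →
          let k∈xs , k≤i , k≢i = ∈-filter⁻ P? {xs = xs} k∈
          in ∈-filter⁺ P? (xs-↓ j≤k k∈xs) (⪯-trans j≤k k≤i , λ { refl → k≢i (er.antisym k≤i j≤k) })
      ; configuration = A.IsConfiguration-resp-≐
          ( (λ { (j , (_ , here refl , j≤i) , eq) → to j j≤i eq })
          , (λ { (inj₁ (j , j∈ , eq)) → j , (i , here refl , proj₁ (proj₂ (∈-filter⁻ P? {xs = xs} j∈))) , eq
               ; (inj₂ eq) → i , (i , here refl , er.≤-refl) , A.trans i≈a eq }) )
          (er.Con-singleton i)
      } i∈) refl
      where
        P? = λ j → em {P = j er.≤ i × j ≢ i}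
        to : ∀ j {s} → j er.≤ i → mx j A.≈ s → cone a (filter P? xs) s
        to j j≤i eq with em {P = j ≡ i}
        ... | yes refl = inj₂ (A.trans (A.sym i≈a) eq)
        ... | no j≢i   = inj₁ (j , ∈-filter⁺ P? (xs-↓ j≤i i∈) (j≤i , j≢i) , eq)

    -- Positions replace the indices themselves because `Index` lives in `Set p`, whereas the
    -- carrier of a realisation lives in `Set u`.
    data Node : Set u where
      apex : Node
      node : Fin (length xs) → Node

    at : Fin (length xs) → Index
    at = lookup xs

    index : ∀ {i} → i ∈ xs → ∃ λ k → at k ≡ i
    index i∈ = Any.index i∈ , ≡.sym (lookup-index i∈)

    infix 4 _⊴_

    -- er._≤_ lives in too large a universe for a realisation, hence True.

    _⊴_ : Rel Node u
    _      ⊴ apex   = Lift u ⊤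
    apex   ⊴ node _ = ⊥
    node k ⊴ node l = Lift u (True (em {P = at k er.≤ at l}))

    ⊴⁺ : ∀ {k l} → at k er.≤ at l → node k ⊴ node l
    ⊴⁺ k≤l = lift (fromWitness k≤l)

    ⊴⁻ : ∀ {k l} → node k ⊴ node l → at k er.≤ at l
    ⊴⁻ (lift t) = toWitness t

    label : Node → A.Carrier
    label apex     = a
    label (node k) = mx (at k)

    ⊴-refl : ∀ n → n ⊴ n
    ⊴-refl apex     = _
    ⊴-refl (node k) = ⊴⁺ er.≤-refl

    ⊴-trans : ∀ {m n o} → m ⊴ n → n ⊴ o → m ⊴ o
    ⊴-trans {o = apex} _ _ = _
    ⊴-trans {node _} {node _} {node _} p q = ⊴⁺ (er.≤-trans (⊴⁻ p) (⊴⁻ q))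

    ⊴-antisym : ∀ {m n} → m ⊴ n → n ⊴ m → m ≡ n
    ⊴-antisym {apex}   {apex}   _ _ = refl
    ⊴-antisym {node k} {node l} p q =
      ≡.cong node (Unique⇒lookup-injective xs-unique (er.antisym (⊴⁻ p) (⊴⁻ q)))

    cone⊑labels : cone a xs ⊑ labels label (_⊴ apex)
    cone⊑labels (inj₁ (i , i∈ , eq)) = let k , k≡i = index i∈ in
      node k , _ , A.trans (A.reflexive (≡.cong mx k≡i)) eq
    cone⊑labels (inj₂ eq) = apex , _ , eq

    labels⊑cone : ∀ {x : Pred Node u} → labels label x ⊑ cone a xs
    labels⊑cone (apex , _ , eq)   = inj₂ eq
    labels⊑cone (node k , _ , eq) = inj₁ (at k , ∈-lookup k , eq)

    ↓-configuration : ∀ n → A.IsConfiguration (labels label (_⊴ n))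
    ↓-configuration apex     = A.IsConfiguration-resp-≐ (cone⊑labels , labels⊑cone) configuration
    ↓-configuration (node k) = A.IsConfiguration-resp-≐
      ( (λ { (j , (_ , here refl , j≤) , eq) →
               let l , l≡j = index (xs-↓ j≤ (∈-lookup k))
               in node l , ⊴⁺ (≡.subst (er._≤ at k) (≡.sym l≡j) j≤) , A.trans (A.reflexive (≡.cong mx l≡j)) eq })
      , (λ { (node l , l≤ , eq) → at l , (at k , here refl , ⊴⁻ l≤) , eq }) )
      (er.Con-singleton (at k))

    realisation : Realisation
    realisation = record
      { Carrier        = Node
      ; _≤_            = _⊴_
      ; isPartialOrder = record
        { isPreorder = record
          { isEquivalence = ≡.isEquivalence
          ; reflexive     = λ { {n} refl → ⊴-refl n }
          ; trans         = λ {m} {n} {o} → ⊴-trans {m} {n} {o}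
          }
        ; antisym = ⊴-antisym
        }
      ; ↓-finite       = λ n → Finite-⊆ em {x = λ _ → ⊤} _
          (apex ∷ map node (allFin _) , (λ {m} _ → nodes m) , _)
      ; ρ              = label
      -- A down-closed set is the union of its principal down-sets, whose labels form configurations
      -- inside the cone.
      ; realises       = λ {x} x↓ → A.compatible-union (labels-resp label x) configuration labels⊑cone
          λ (n , xn , eq) → _ , ↓-configuration n , (λ (m , m⊴n , eq) → m , x↓ m⊴n xn , eq) , n , ⊴-refl n , eq
      }
      where
        nodes : ∀ n → n ∈ apex ∷ map node (allFin _)
        nodes apex     = here refl
        nodes (node k) = there (∈-map⁺ node (∈-allFin k))

    open Restriction realisation using () renaming (restrict to ↓)

    module _ (k : Fin (length xs)) where

      private
        index′ : ∀ e → ∃ λ l → at l ≡ below (at k) e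
        index′ e = index (xs-↓ (below-≤ (at k) e) (∈-lookup k))

      -- The element `e` goes to the position of `below (at k) e`, which occurs in `xs` because `xs`
      -- is down-closed.
      rep→↓-fn : rep.Carrier (at k) → Realisation.Carrier (↓ (node k))
      rep→↓-fn e = let l , l≡ = index′ e in
        sub {e = node l} (⊴⁺ (≡.subst (er._≤ at k) (≡.sym l≡) (below-≤ (at k) e)))

      rep→↓-fn-≡ : ∀ {e l t} → below (at k) e ≡ at l → rep→↓-fn e ≡ (node l , t)
      rep→↓-fn-≡ {e} eq =
        Sub-≡ (≡.cong node (Unique⇒lookup-injective xs-unique (≡.trans (proj₂ (index′ e)) eq)))

      rep→↓ : Map (rep.realisation (at k)) (↓ (node k))
      rep→↓ = record
        { fn          = just ∘ rep→↓-fn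
        ; surjective  = λ { (apex , t)       → contradiction (member {P = _⊴ node k} (apex , t)) λ ()
                          ; s@(node l , _) → let f = ⊴⁻ (member {P = _⊴ node k} s) in
                              proj₁ (Map.surjective f (rep.top (at l))) ,
                              ≡.cong just (rep→↓-fn-≡ (below-surjective f)) }
        ; preserves-↓ = lifts⇒preserves (rep.realisation (at k)) (↓ (node k)) (just ∘ rep→↓-fn)
            λ { {apex , _} refl ()
              ; {node l , _} {e} refl l≤ →
                  let d , d≤e , eq = below-lifts e (≡.subst (at l er.≤_) (proj₂ (index′ e)) (⊴⁻ l≤))
                  in d , d≤e , ≡.cong just (rep→↓-fn-≡ eq) }
        ; commutes    = λ { {e} refl → A.trans (max-below (at k) e)
                                        (A.reflexive (≡.cong mx (≡.sym (proj₂ (index′ e))))) }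
        }

    -- Extremality of the realisation with a new top

    module TotalMap {R′ : Realisation} (g : Map realisation R′) (g-total : Map.Total g) where
      private
        module R′ = Realisation R′
        module g  = Map g

      to : Node → R′.Carrier
      to n = proj₁ (g-total n)

      g-to : ∀ n → g.fn n ≡ just (to n)
      g-to n = proj₂ (g-total n)

      to-≡ : ∀ {n v} → g.fn n ≡ just v → to n ≡ v
      to-≡ gn = just-injective (≡.trans (≡.sym (g-to _)) gn)

      rep→↓to : ∀ k → Map (rep.realisation (at k)) (Restriction.restrict R′ (to (node k)))
      rep→↓to k = ⪯-trans (restrict-map g (g-to (node k))) (rep→↓ k)

      -- By `total` it is enough to look at the top of `rep (at k)`: `below` sends it to `at k`, so
      -- it goes to `node k` and on to `to (node k)`.
      rep→↓to-total : ∀ k → Map.Total (rep→↓to k)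
      rep→↓to-total k = total (rep (at k)) (rep→↓to k) {sub R′.≤-refl} (≡.trans
        (≡.cong (Map.fn (restrict-map g (g-to (node k))))
          (rep→↓-fn-≡ k {t = proj₂ (sub {P = _⊴ node k} {node k} (⊴-refl (node k)))} (below-surjective {at k} {at k} ⪯-refl)))
        (≡.trans (≡.cong (_>>= toSub) (g-to (node k))) (toSub-member (sub R′.≤-refl))))

      -- The inverse of `rep→↓to k`, which is an isomorphism because `rep (at k)` is extremal.
      ↓to→rep : ∀ k → Map (Restriction.restrict R′ (to (node k))) (rep.realisation (at k))
      ↓to→rep k = proj₁ (rep.extremal (at k) (rep→↓to k) (rep→↓to-total k))

      -- Since `rep→↓to k` is total, the restriction of `g` discards no value on the down-set of
      -- `node k`; each of these values thus lies below `to (node k)`.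
      to-monotone-node : ∀ {l k} → at l er.≤ at k → to (node l) R′.≤ to (node k)
      to-monotone-node {l} {k} l≤k =
        let e , eq = Map.surjective (rep→↓ k) (sub (⊴⁺ l≤k))
            t , te = rep→↓to-total k e
            c , gc , ct = >>=-just (g.fn (node l))
                            (≡.trans (≡.cong (_>>= Map.fn (restrict-map g (g-to (node k)))) (≡.sym eq)) te)
        in ≡.subst (R′._≤ to (node k)) (≡.trans (toSub-just ct) (≡.sym (to-≡ gc))) (member t)

      -- Both representatives map to the down-set of the common value, and the map from `rep (at l)`
      -- can be inverted.
      at-≤ : ∀ {k l} → to (node k) ≡ to (node l) → at l er.≤ at k
      at-≤ {k} {l} eq = ⪯-trans (↓to→rep l)
        (≡.subst (λ v → Map (rep.realisation (at k)) (Restriction.restrict R′ v)) eq (rep→↓to k))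

      to-injective : ∀ m n → to m ≡ to n → m ≡ n
      to-injective apex     apex     _  = refl
      -- Equal values carry equal labels, but `a` labels no node by `a-fresh`.
      to-injective apex     (node k) eq = contradiction
        (A.trans (g.commutes (g-to (node k)))
          (A.trans (A.reflexive (≡.cong R′.ρ (≡.sym eq))) (A.sym (g.commutes (g-to apex)))))
        (a-fresh (∈-lookup k))
      to-injective (node k) apex     eq = ≡.sym (to-injective apex (node k) (≡.sym eq))
      to-injective (node k) (node l) eq = ≡.cong node (Unique⇒lookup-injective xs-unique
        (er.antisym {at k} {at l} (at-≤ (≡.sym eq)) (at-≤ eq)))

      -- The nodes sent below `to apex` form a candidate: its cone is the set of labels of the
      -- down-set of `to apex`, a configuration because `R′` is a realisation. By minimality these
      -- are all the nodes.
      to≤apex : ∀ k → to (node k) R′.≤ to apex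
      to≤apex k =
        let l , l≡k , l≤ = filter-all {P = Below} record
              { xs-unique     = Unique.filter⁺ P? xs-unique
              ; xs-↓          = λ {i} {j} i≤j j∈ →
                  let j∈xs , n , n≡j , n≤ = ∈-filter⁻ P? {xs = xs} j∈
                      i∈xs = xs-↓ i≤j j∈xs
                      m , m≡i = index i∈xs
                      m≤n = ≡.subst₂ er._≤_ (≡.sym m≡i) (≡.sym n≡j) i≤j
                  in ∈-filter⁺ P? i∈xs (m , m≡i , R′.≤-trans (to-monotone-node m≤n) n≤)
              ; configuration = A.IsConfiguration-resp-≐ (⊑cone , cone⊑)
                                  (R′.realises (↓-down R′ (to apex)))
              } (∈-lookup k)
        in ≡.subst (λ n → to (node n) R′.≤ to apex) (Unique⇒lookup-injective xs-unique l≡k) l≤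
        where
          Below : Pred Index _
          Below j = ∃ λ n → at n ≡ j × to (node n) R′.≤ to apex
          P? = λ j → em {P = Below j}

          ⊑cone : labels R′.ρ (R′._≤ to apex) ⊑ cone a (filter P? xs)
          ⊑cone (v , v≤ , eq) with lifts g (g-to apex) v≤
          ... | apex   , _ , gn = inj₂ (A.trans (g.commutes gn) eq)
          ... | node n , _ , gn = inj₁ (at n ,
            ∈-filter⁺ P? (∈-lookup {xs = xs} n) (n , refl , ≡.subst (R′._≤ to apex) (≡.sym (to-≡ gn)) v≤) ,
            A.trans (g.commutes gn) eq)

          cone⊑ : cone a (filter P? xs) ⊑ labels R′.ρ (R′._≤ to apex)
          cone⊑ (inj₂ eq) = to apex , R′.≤-refl , A.trans (A.sym (g.commutes (g-to apex))) eq
          cone⊑ (inj₁ (i , i∈ , eq)) with ∈-filter⁻ P? {xs = xs} i∈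
          ... | _ , n , refl , n≤ = to (node n) , n≤ , A.trans (A.sym (g.commutes (g-to (node n)))) eq

      to-monotone : ∀ m n → m ⊴ n → to m R′.≤ to n
      to-monotone apex     apex     _ = R′.≤-refl
      to-monotone (node k) apex     _ = to≤apex k
      to-monotone (node l) (node k) t = to-monotone-node (⊴⁻ t)

      isIso : IsIso g
      isIso = mk-iso g g-total
        (λ {m} {n} gm gn → to-injective m n (≡.trans (to-≡ gm) (≡.sym (to-≡ gn))))
        (λ {m} {n} gm gn m⊴n → ≡.subst₂ R′._≤_ (to-≡ gm) (to-≡ gn) (to-monotone m n m⊴n))

    -- The index of the new realisation and one-event extension

    topExtremal : TopExtremal
    topExtremal = record
      { realisation = realisation
      ; extremal    = TotalMap.isIso
      ; top         = apex
      ; ≤-top       = _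
      }

    abstract
      code : Index
      code = proj₁ (complete topExtremal)

      ≅code : realisation ≅ rep.realisation code
      ≅code = proj₂ (complete topExtremal)

    max-code : mx code A.≈ a
    max-code = A.sym (top-≅ topExtremal (rep code) ≅code)

    -- Restricting to the top is total, hence invertible by extremality; this is the inverse.
    ↓apex→realisation : Map (↓ apex) realisation
    ↓apex→realisation = proj₁ (TotalMap.isIso restriction
      (total topExtremal restriction (toSub-member (sub (⊴-refl apex)))))
      where open Restriction realisation apex using (restriction)

    ↓≅⇒∈ : ∀ {j} n → ↓ n ≅ rep.realisation j → j er.≤ code → j ≡ code ⊎ j ∈ xs
    ↓≅⇒∈ {j} (node k) (f , _) _ =
      inj₂ (xs-↓ {j} {at k} (⪯-trans f (rep→↓ k)) (∈-lookup k))
    ↓≅⇒∈ {j} apex (_ , f , _) j≤ = inj₁ (er.antisym {j} {code} j≤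
      (⪯-trans {rep.realisation code} {realisation} {rep.realisation j} (proj₁ ≅code)
        (⪯-trans {realisation} {↓ apex} {rep.realisation j} ↓apex→realisation f)))

    -- By `below-≅`, `rep j` is the down-set of some `n`. If `n` is a node, `j` lies below a member
    -- of `xs`; if it is the apex, `j` is `code` by antisymmetry.
    ≤code⇒∈ : ∀ {j} → j er.≤ code → j ≡ code ⊎ j ∈ xs
    ≤code⇒∈ {j} j≤ =
      let n , ↓≅j = below-≅ topExtremal (rep j)
                      (⪯-trans {rep.realisation j} {rep.realisation code} {realisation} j≤ (proj₁ ≅code))
      in ↓≅⇒∈ n ↓≅j j≤

  Extends : A.Carrier → List Index → Pred Index _
  Extends a D i = mx i A.≈ a × (∀ {j} → j er.≤ i → j ≡ i ⊎ j ∈ D)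

  extension : ∀ {a D} → DownClosed er._≤_ (_∈ D) → A.IsConfiguration (cone a D) → ∃ (Extends a D)
  extension {a} {D} D↓ cfg =
    -- The minimum exists because `D` with repetitions removed is itself a candidate.
    let xs , (xs⊆D , cand) , least = minimal em length {P = λ xs → xs ⊆ D × Candidate a xs} (D′ , D′⊆D , record
          { xs-unique     = deduplicate-! _≟_ D
          ; xs-↓          = λ i≤j j∈ → D⊆D′ (D↓ i≤j (D′⊆D j∈))
          ; configuration = A.IsConfiguration-resp-≐ (cone-⊆ D⊆D′ , cone-⊆ D′⊆D) cfg
          })
        open Apex cand (λ ys⊆xs c → least (xs⊆D ∘ ys⊆xs , c))
    in code , max-code , λ j≤ → Sum.map₂ xs⊆D (≤code⇒∈ j≤)
    where
      _≟_ : (i j : Index) → Dec (i ≡ j)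
      _ ≟ _ = em
      D′ = deduplicate _≟_ D
      D⊆D′ : D ⊆ D′
      D⊆D′ = ∈-deduplicate⁺ _≟_
      D′⊆D : D′ ⊆ D
      D′⊆D = ∈-deduplicate⁻ _≟_ D
      cone-⊆ : ∀ {xs ys} → xs ⊆ ys → cone a xs ⊑ cone a ys
      cone-⊆ xs⊆ys (inj₁ (i , i∈ , eq)) = inj₁ (i , xs⊆ys i∈ , eq)
      cone-⊆ _     (inj₂ eq)            = inj₂ eq

-- Definition of the factorisation by well-founded recursion

module Factorisation (em : Classical) (A : GES u u u u) (choice : Choice A p)
                     (Q : ESE u u u u) (f : GESMap (ges Q) A) where
  open Realisations em A choice
  open Chains A
  module A  = GES A
  module Q  = ESE Q
  module gQ = GES (ges Q)
  module f  = GESMap f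
  open WellFoundedOrder em Q.eventStructure

  f⟨_⟩ : Pred Q.Carrier ℓ → Pred A.Carrier _
  f⟨ x ⟩ s = ∃ λ q → x q × ∃ λ b → f.fn q ≡ just b × b A.≈ s

  f⟨⟩-Con : ∀ {X S} → Q.Con X → All f⟨ _∈ X ⟩ S → A.Con S
  f⟨⟩-Con {X} {S} X∈ S⊆ = A.Con-⊆ S⊆fX (f.preserves-Con (X , X∈ , id , id))
    where
      S⊆fX : S A.⊆ₛ mapMaybe f.fn X
      S⊆fX s∈ =
        let t , t∈ , s≈t = find A.events s∈
            q , q∈ , b , fq , b≈t = All.lookup S⊆ t∈
        in Any.map (λ { refl → A.trans s≈t (A.sym b≈t) }) (∈-mapMaybe⁺ f.fn X q∈ fq)

  ↓-Con : ∀ q {X} → All (Q._≤ q) X → Q.Con X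
  ↓-Con q X≤ = Q.Con-⊆ ∈-++⁺ˡ (go X≤)
    where
      go : ∀ {X} → All (Q._≤ q) X → Q.Con (X ++ [ q ])
      go []                     = Q.Con-singleton q
      go {_ ∷ X} (r≤q ∷ X≤) = Q.Con-↓ (go X≤) r≤q (∈-++⁺ʳ X (here refl))

  -- The hypotheses of `extension` concern earlier values of `h`, so they become available only
  -- after `h` is defined. Hence the default `nothing`, which `realises-h` later excludes wherever
  -- `f` is defined.
  select : A.Carrier → List Index → Maybe Index
  select b D = Maybe.map proj₁ (dec⇒maybe (em {P = ∃ (Extends b D)}))

  select-just : ∀ {b D} → ∃ (Extends b D) → ∃ λ i → select b D ≡ just i × Extends b D i
  select-just {b} {D} ext with em {P = ∃ (Extends b D)}
  ... | yes (i , e) = i , refl , e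
  ... | no none     = contradiction ext none

  step : ∀ q → WfRec _<_ (λ _ → Maybe Index) q → Maybe Index
  step q h = f.fn q >>= λ b → select b (mapMaybe (λ (r , r<q) → h r<q) (lower q))

  -- The unfolding equation of `h` rests on `step` depending only on the values of its recursive
  -- argument.
  step-cong : ∀ q {h h′ : WfRec _<_ (λ _ → Maybe Index) q} →
              (∀ {r} (r<q : r < q) → h r<q ≡ h′ r<q) → step q h ≡ step q h′
  step-cong q h≗h′ = ≡.cong (λ D → f.fn q >>= λ b → select b D)
    (mapMaybe-cong (λ (_ , r<q) → h≗h′ r<q) (lower q))

  abstract
    h : Q.Carrier → Maybe Index
    h = WF.All.wfRec <-wf _ (λ _ → Maybe Index) step

  below-h : Q.Carrier → List Index
  below-h q = mapMaybe (h ∘ proj₁) (lower q)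

  abstract
    h-unfold : ∀ q → h q ≡ (f.fn q >>= λ b → select b (below-h q))
    h-unfold q = FixPoint.unfold-wfRec <-wf (λ _ → Maybe Index) step step-cong

  h-defined : ∀ {q i} → h q ≡ just i → ∃ λ b → f.fn q ≡ just b
  h-defined {q} hq =
    let b , fq , _ = >>=-just (f.fn q) (≡.trans (≡.sym (h-unfold q)) hq) in b , fq

  ∈-below-h⁺ : ∀ {q r i} → r < q → h r ≡ just i → i ∈ below-h q
  ∈-below-h⁺ {q} r<q hr = ∈-mapMaybe⁺ (h ∘ proj₁) (lower q) (proj₂ (∈-lower r<q)) hr

  ∈-below-h⁻ : ∀ {q i} → i ∈ below-h q → ∃ λ r → r < q × h r ≡ just i
  ∈-below-h⁻ {q} i∈ = let (r , r<q) , _ , hr = ∈-mapMaybe⁻ (h ∘ proj₁) (lower q) i∈ in r , r<q , hr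

  -- The induction invariant. Its last clause keeps the earlier values down-closed, as `extension`
  -- requires, and later makes images of configurations down-closed.
  Realises : Pred Q.Carrier _
  Realises q = ∀ {b} → f.fn q ≡ just b → ∃ λ i → h q ≡ just i × mx i A.≈ b ×
               (∀ {j} → j er.≤ i → ∃ λ r → r Q.≤ q × h r ≡ just j)

  -- Induction step: the cone over the earlier values is a configuration

  module Step {q} (IH : ∀ {r} → r < q → Realises r) {b} (fq : f.fn q ≡ just b) where

    D = below-h q

    IH-max : ∀ {r i} → r < q → h r ≡ just i → ∃ λ c → f.fn r ≡ just c × c A.≈ mx i
    IH-max r<q hr =
      let c , fr = h-defined hr
          i′ , hr′ , eq , _ = IH r<q fr
      in c , fr , A.trans (A.sym eq) (A.reflexive (≡.cong mx (just-injective (≡.trans (≡.sym hr′) hr))))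

    D-↓ : DownClosed er._≤_ (_∈ D)
    D-↓ {j} {i} j≤i i∈ =
      let r , r<q , hr = ∈-below-h⁻ i∈
          i′ , hr′ , _ , lo = IH r<q (proj₂ (h-defined hr))
          s , s≤r , hs = lo (≡.subst (j er.≤_) (just-injective (≡.trans (≡.sym hr) hr′)) j≤i)
      in ∈-below-h⁺ (<-≤-trans r<q s≤r) hs

    -- This gives consistency of the cone: the down-set of `q` is consistent and `f` preserves
    -- consistency.
    cone-values : cone b D ⊑ f⟨ Q._≤ q ⟩
    cone-values (inj₁ (i , i∈ , eq)) =
      let r , r<q , hr = ∈-below-h⁻ i∈
          c , fr , c≈ = IH-max r<q hr
      in r , proj₁ r<q , c , fr , A.trans c≈ eq
    cone-values (inj₂ eq) = q , Q.≤-refl , b , fq , eq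

    cone-Con : ∀ {S} → All (cone b D) S → A.Con S
    cone-Con S⊆ = f⟨⟩-Con {proj₁ (Q.↓-finite q)}
      (↓-Con q (All.tabulate (proj₂ (proj₂ (Q.↓-finite q)))))
      (All.map (λ s∈ → let r , r≤q , v = cone-values s∈ in r , proj₁ (proj₂ (Q.↓-finite q)) r≤q , v) S⊆)

    X : List Q.Carrier
    X = map proj₁ (lower q)

    -- Transported along `f`, this enabling secures the new element `b` of the cone.
    X⊢q : X gQ.⊢ q
    X⊢q = (X , ↓-Con q (Allₚ.map⁺ (All.tabulate λ {(_ , r<q)} _ → proj₁ r<q)) , id , id) ,
          q , Q.~-refl , ↓q
      where
        ↓q : ∀ {r} → r Q.≤ q → r gQ.∈ₛ q ∷ X
        ↓q r≤q with ≤⇒≡⊎< r≤q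
        ... | inj₁ refl = here Q.~-refl
        ... | inj₂ r<q  = there (Any.map Q.~-reflexive (∈-map⁺ proj₁ (proj₂ (∈-lower r<q))))

    -- A securing chain inside the configuration `max[i]` stays in the cone because `D` is
    -- down-closed.
    D-secured : ∀ {i s} → i ∈ D → mx i A.≈ s → ∃ λ es → A.Chain (cone b D) (s ∷ es)
    D-secured {i} i∈ eq =
      let es , ch = A.IsConfiguration.secured (er.Con-singleton i) (i , (i , here refl , er.≤-refl {i}) , eq)
      in es , Chain-mono (λ { (j , (_ , here refl , j≤i) , eq) → inj₁ (j , D-↓ j≤i i∈ , eq) }) ch

    fX-secured : All (λ s → ∃ λ es → A.Chain (cone b D) (s ∷ es)) (mapMaybe f.fn X)
    fX-secured = All.tabulate λ s∈ →
      let r , r∈ , fr = ∈-mapMaybe⁻ f.fn X s∈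
          (_ , r<q) , _ , r≡ = ∈-map⁻ proj₁ r∈
          i , hr , eq , _ = IH (≡.subst (_< q) (≡.sym r≡) r<q) fr
      in D-secured (∈-below-h⁺ (≡.subst (_< q) (≡.sym r≡) r<q) hr) eq

    cone-configuration : A.IsConfiguration (cone b D)
    cone-configuration = record
      { resp       = λ { s≈t (inj₁ (i , i∈ , eq)) → inj₁ (i , i∈ , A.trans eq s≈t)
                       ; s≈t (inj₂ eq)            → inj₂ (A.trans eq s≈t) }
      ; consistent = cone-Con
      ; secured    = λ
          { (inj₁ (i , i∈ , eq)) → D-secured i∈ eq
          ; (inj₂ eq)            → secured-⊢ cone-Con fX-secured (A.⊢-resp eq (f.preserves-⊢ X⊢q fq)) (inj₂ eq) }
      }

    step-realises : ∃ λ i → h q ≡ just i × mx i A.≈ b × (∀ {j} → j er.≤ i → ∃ λ r → r Q.≤ q × h r ≡ just j)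
    step-realises = from (select-just (extension D-↓ cone-configuration))
      where
        from : (∃ λ i → select b D ≡ just i × Extends b D i) → _
        from (i , sel , i≈b , lo) = i , hq , i≈b , λ {j} j≤i → lower-realised (lo {j} j≤i)
          where
            hq : h q ≡ just i
            hq = ≡.trans (h-unfold q) (≡.trans (≡.cong (_>>= λ b → select b D) fq) sel)
            lower-realised : ∀ {j} → j ≡ i ⊎ j ∈ D → ∃ λ r → r Q.≤ q × h r ≡ just j
            lower-realised (inj₁ refl) = q , Q.≤-refl , hq
            lower-realised (inj₂ j∈)   = let r , r<q , hr = ∈-below-h⁻ j∈ in r , proj₁ r<q , hr

  -- The resulting map of event structures with equivalence

  realises-h : ∀ q → Realises q
  realises-h = WF.All.wfRec <-wf _ Realises λ q IH → Step.step-realises IH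

  h-value : ∀ {q i} → h q ≡ just i → ∃ λ b → f.fn q ≡ just b × b A.≈ mx i
  h-value hq =
    let b , fq = h-defined hq
        i′ , hq′ , eq , _ = realises-h _ fq
    in b , fq , A.trans (A.sym eq) (A.reflexive (≡.cong mx (just-injective (≡.trans (≡.sym hq′) hq))))

  h-↓ : ∀ {q i j} → h q ≡ just i → j er.≤ i → ∃ λ r → r Q.≤ q × h r ≡ just j
  h-↓ {j = j} hq j≤i =
    let b , fq = h-defined hq
        i′ , hq′ , _ , lo = realises-h _ fq
    in lo (≡.subst (j er.≤_) (just-injective (≡.trans (≡.sym hq) hq′)) j≤i)

  h-factorises : ∀ q → Pointwise A._≈_ (f.fn q) (h q >>= just ∘ mx)
  h-factorises q with f.fn q in fq
  ... | just b  = let i , hq , eq , _ = realises-h q fq in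
    ≡.subst (λ m → Pointwise A._≈_ (just b) (m >>= just ∘ mx)) (≡.sym hq) (Pointwise.just (A.sym eq))
  ... | nothing = ≡.subst (λ m → Pointwise A._≈_ nothing (m >>= just ∘ mx))
    (≡.sym (≡.trans (h-unfold q) (≡.cong (_>>= λ b → select b (below-h q)) fq))) Pointwise.nothing

  -- Equivalence in `er` is equality of maxima, and `max` is total. Both `h-cong` and uniqueness
  -- reduce to this.
  pointwise-max : ∀ {m n : Maybe Index} → Pointwise A._≈_ (m >>= just ∘ mx) (n >>= just ∘ mx) → Pointwise er._~_ m n
  pointwise-max {just _}  {just _}  (Pointwise.just eq) = Pointwise.just eq
  pointwise-max {nothing} {nothing} _                   = Pointwise.nothing

  h-image-↓ : ∀ X → Q.IsConfiguration (_∈ X) → DownClosed er._≤_ (_∈ mapMaybe h X)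
  h-image-↓ X cX {i} {j} i≤j j∈ =
    let q , q∈ , hq = ∈-mapMaybe⁻ h X j∈
        r , r≤q , hr = h-↓ {q} {j} {i} hq i≤j
    in ∈-mapMaybe⁺ h X (Q.IsConfiguration.down-closed cX r≤q q∈) hr

  -- The image is already down-closed, so every maximum involved is a value of `f` on the consistent
  -- set `X`. Securing chains come from the configurations `max[j]`.
  h-image-Con : ∀ X → Q.IsConfiguration (_∈ X) → er.Con (mapMaybe h X)
  h-image-Con X cX = record
    { resp       = λ { s≈t (i , i≤ , eq) → i , i≤ , A.trans eq s≈t }
    ; consistent = λ S⊆ → f⟨⟩-Con {X = X} (Q.IsConfiguration.consistent cX (All.tabulate id)) (All.map values S⊆)
    ; secured    = λ { (i , (j , j∈ , i≤j) , eq) →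
        let es , ch = A.IsConfiguration.secured (er.Con-singleton j) (i , (j , here refl , i≤j) , eq)
        in es , Chain-mono (max↓-mono j∈) ch }
    }
    where
      values : max↓ em A choice (mapMaybe h X) ⊑ f⟨ _∈ X ⟩
      values (i , (j , j∈ , i≤j) , eq) =
        let q , q∈ , hq = ∈-mapMaybe⁻ h X (h-image-↓ X cX {i} {j} i≤j j∈)
            b , fq , b≈ = h-value hq
        in q , q∈ , b , fq , A.trans b≈ eq

      max↓-mono : ∀ {j} → j ∈ mapMaybe h X → max↓ em A choice [ j ] ⊑ max↓ em A choice (mapMaybe h X)
      max↓-mono j∈ (k , (_ , here refl , k≤j) , eq) = k , (_ , j∈ , k≤j) , eq

  h-cong : Congruent Q.~-setoid er.~-setoid h
  h-cong {q} {r} q~r = pointwise-max (Pointwise.trans A.trans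
    (Pointwise.sym A.sym (h-factorises q)) (Pointwise.trans A.trans (f.cong q~r) (h-factorises r)))

  h-reflects-~ : ∀ X → Q.IsConfiguration (_∈ X) → ∀ {q r i j} → q ∈ X → r ∈ X →
                 h q ≡ just i → h r ≡ just j → i er.~ j → q Q.~ r
  h-reflects-~ X cX {q} {r} {i} {j} q∈ r∈ hq hr i~j =
    let b , fq , b≈i = h-value hq
        c , fr , c≈j = h-value hr
    in f.injective (X , Q.IsConfiguration.consistent cX (All.tabulate id) , id , id)
         (Any.map Q.~-reflexive q∈) (Any.map Q.~-reflexive r∈) fq fr
         (A.trans {b} {mx i} {c} b≈i (A.trans {mx i} {mx j} {c} i~j (A.sym c≈j)))

  hMap : ESEMap Q (er em A choice)
  hMap = mk-ESEMap Q (er em A choice) h h-cong h-image-↓ h-image-Con h-reflects-~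

-- Existence and uniqueness of the factorisation

mainTheorem2 : (em : Classical) →
    ∀ {u p : Level} (A : GES u u u u) (choice : Choice A p) →
    (Q : ESE u u u u) (f : GESMap (ges Q) A) →
    ∃ λ (h : ESEMap Q (er em A choice)) →
    (f ≗ᴳ (maxMap em A choice ∘ᴳ gesMap h)) ×
    ((h′ : ESEMap Q (er em A choice)) →
    f ≗ᴳ (maxMap em A choice ∘ᴳ gesMap h′) → h′ ≋ h)
mainTheorem2 em A choice Q f =
  hMap , h-factorises , λ h′ f≗ q → pointwise-max
    (Pointwise.trans A.trans (Pointwise.sym A.sym (f≗ q)) (h-factorises q))
  where open Factorisation em A choice Q f
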